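{- Fix an integer $n\geq 2$ and let $$L_n(h,d)=\max\{\mathcal{N}(M)\mid M\text{ a strongly locally scoped term with }\mathrm{ord}(M)\leq n,\ \mathrm{lh}(M)\leq h,\ \mathrm{depth}(M)\leq d\}.$$ Then $L_n(h,d)=2_{n-1}^{\Theta(d\log h)}$, i.e. there exist real constants $c_1,c_2>0$ and $K\in\mathbb{N}$ such that for all integers $h,d\geq K$, $$2_{n-1}^{\,c_1d\log h}\leq L_n(h,d)\leq 2_{n-1}^{\,c_2d\log h}.$$
   Context: **Towers.** $2_0^x=x$ and $2_{k+1}^x=2^{(2_k^x)}$; $\log$ is base 2. **Terms.** Types are $A,B::=o\mid A\to B$. Terms are those of the simply-typed $\lambda$-calculus à la Church: $M,N::=\lambda x^A.M\mid M\,N\mid x\mid *_A$, with one constant $*_A:A$ for each type $A$ and the usual typing rules. All terms are well-typed, taken up to $\alpha$-equivalence, and obey Barendregt's convention. **Order.** $\mathrm{lv}(o)=0$, $\mathrm{lv}(A\to B)=\max(\mathrm{lv}(A)+1,\mathrm{lv}(B))$; the level of a term is the level of its type; $\mathrm{ord}(M)$ is the maximal level of a subterm of $M$. **Linear head reduction.** The prime redexes of a term are pairs $(\lambda x,N)$ defined by induction on length: $*\,M_1\dots M_n$ and $x\,M_1\dots M_n$ have none; those of $\lambda x.M'$ are those of $M'$; those of $(\lambda x.M')M_1\dots M_n$ ($n\geq1$) are $(\lambda x,M_1)$ together with those of $M'\,M_2\dots M_n$. The generalized redexes of $M$ are the prime redexes of all subterms of $M$. The head occurrence of $M$ is its leftmost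 occurrence of a variable or constant. If the head occurrence is an occurrence $x_0$ of a variable $x$ and $(\lambda x,N)$ is a prime redex of $M$, then $M\to_{\mathrm{lhr}}M[N/x_0]$, where only the occurrence $x_0$ is replaced. This is deterministic; $\mathcal{N}(M)$ is the length of the reduction sequence from $M$. **Strong local scope.** $M$ is strongly locally scoped if for every generalized redex $(\lambda x,N)$ in $M$, $N$ is closed. **Measures.** $\mathrm{depth}$: $\mathrm{depth}(*M_1\dots M_n)=1$; $\mathrm{depth}(x\,M_1\dots M_n)=\max_{i}\mathrm{depth}(M_i)$ (equal to $1$ if $n=0$); $\mathrm{depth}(\lambda x.M)=\mathrm{depth}(M)$; $\mathrm{depth}((\lambda x.M)M_1\dots M_n)=\max(\mathrm{depth}(M\,M_2\dots M_n),\mathrm{depth}(M_1)+1)$. Local height: $\mathrm{lh}(*M_1\dots M_n)=0$; $\mathrm{lh}(x\,M_1\dots M_n)=1+\max_i\mathrm{lh}(M_i)$ (equal to $1$ if $n=0$); $\mathrm{lh}(\lambda x.M)=\mathrm{lh}(M)$; $\mathrm{lh}((\lambda x.M)M_1\dots M_n)=\max(\mathrm{lh}(M\,M_2\dots M_n),\mathrm{lh}(M_1))$. -}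

module Defs where

open import Data.Integer using (∣_∣)
open import Data.List using (List; []; _∷_; foldr)
open import Data.List.Membership.Propositional using (_∈_)
open import Data.List.Relation.Binary.Subset.Propositional using (_⊆_)
open import Data.List.Relation.Binary.Subset.Propositional.Properties using (∷⁺ʳ)
open import Data.List.Relation.Unary.Any using (here; there)
open import Data.Maybe using (Maybe; just; nothing)
open import Data.Nat using (ℕ; zero; suc; _+_; _*_; _^_; _⊔_; _≤_; NonZero)
open import Data.Product using (Σ-syntax; ∃-syntax; _×_)
open import Data.Rational.Unnormalised using (ℚᵘ; ↥_; ↧ₙ_)
open import Relation.Binary.PropositionalEquality using (_≡_; refl)
open import Relation.Nullary using (¬_)

infixr 7 _⇒_
infix  4 _⊢_
infixl 7 _·_

data Type : Set where
  o   : Type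
  _⇒_ : Type → Type → Type

Ctx : Set
Ctx = List Type

-- Intrinsically typed de Bruijn terms, so that propositional equality is
-- α-equivalence.  A variable of type A is a proof of A ∈ Γ.
data _⊢_ (Γ : Ctx) : Type → Set where
  var : ∀ {A} → A ∈ Γ → Γ ⊢ A
  ƛ   : ∀ {A B} → A ∷ Γ ⊢ B → Γ ⊢ A ⇒ B
  _·_ : ∀ {A B} → Γ ⊢ A ⇒ B → Γ ⊢ A → Γ ⊢ B
  ∗   : ∀ {A} → Γ ⊢ A

rename : ∀ {Γ Δ A} → Γ ⊆ Δ → Γ ⊢ A → Δ ⊢ A
rename ρ (var x) = var (ρ x)
rename ρ (ƛ M)   = ƛ (rename (∷⁺ʳ _ ρ) M)
rename ρ (M · N) = rename ρ M · rename ρ N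
rename ρ ∗       = ∗

data _FreeIn_ : ∀ {Γ A B} → A ∈ Γ → Γ ⊢ B → Set where
  var  : ∀ {Γ A} {x : A ∈ Γ} → x FreeIn var x
  ƛ    : ∀ {Γ A B C} {x : A ∈ Γ} {M : C ∷ Γ ⊢ B} → there x FreeIn M → x FreeIn ƛ M
  appˡ : ∀ {Γ A B C} {x : A ∈ Γ} {M : Γ ⊢ B ⇒ C} {N : Γ ⊢ B} → x FreeIn M → x FreeIn (M · N)
  appʳ : ∀ {Γ A B C} {x : A ∈ Γ} {M : Γ ⊢ B ⇒ C} {N : Γ ⊢ B} → x FreeIn N → x FreeIn (M · N)

Closed : ∀ {Γ A} → Γ ⊢ A → Set
Closed {Γ} M = ∀ {A} (x : A ∈ Γ) → ¬ (x FreeIn M)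

data _SubtermOf_ {Δ B} (P : Δ ⊢ B) : ∀ {Γ A} → Γ ⊢ A → Set where
  self : P SubtermOf P
  ƛ    : ∀ {Γ A C} {M : C ∷ Γ ⊢ A} → P SubtermOf M → P SubtermOf ƛ M
  appˡ : ∀ {Γ A C} {M : Γ ⊢ C ⇒ A} {N : Γ ⊢ C} → P SubtermOf M → P SubtermOf (M · N)
  appʳ : ∀ {Γ A C} {M : Γ ⊢ C ⇒ A} {N : Γ ⊢ C} → P SubtermOf N → P SubtermOf (M · N)

lv : Type → ℕ
lv o       = 0
lv (A ⇒ B) = suc (lv A) ⊔ lv B

ord : ∀ {Γ A} → Γ ⊢ A → ℕ
ord {A = A} (var x) = lv A
ord {A = A} (ƛ M)   = lv A ⊔ ord M
ord {A = A} (M · N) = lv A ⊔ (ord M ⊔ ord N)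
ord {A = A} ∗       = lv A

-- The path from the root of a term to its head occurrence goes under
-- abstractions and to the left of applications.  headCtx M is the context at
-- the head occurrence, i.e. Γ extended by the abstractions on that path.

headCtx : ∀ {Γ A} → Γ ⊢ A → Ctx
headCtx {Γ} (var x) = Γ
headCtx (ƛ M)       = headCtx M
headCtx (M · N)     = headCtx M
headCtx {Γ} ∗       = Γ

headType : ∀ {Γ A} → Γ ⊢ A → Type
headType {A = A} (var x) = A
headType (ƛ M)           = headType M
headType (M · N)         = headType M
headType {A = A} ∗       = A

headVar : ∀ {Γ A} (M : Γ ⊢ A) → Maybe (headType M ∈ headCtx M)
headVar (var x) = just x
headVar (ƛ M)   = headVar M
headVar (M · N) = headVar M
headVar ∗       = nothing

toHead : ∀ {Γ A} (M : Γ ⊢ A) → Γ ⊆ headCtx M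
toHead (var y) x = x
toHead (ƛ M)   x = toHead M (there x)
toHead (M · N) x = toHead M x
toHead ∗       x = x

replaceHead : ∀ {Γ A} (M : Γ ⊢ A) → headCtx M ⊢ headType M → Γ ⊢ A
replaceHead (var x) P = P
replaceHead (ƛ M)   P = ƛ (replaceHead M P)
replaceHead (M · N) P = replaceHead M P · N
replaceHead ∗       P = P

-- Args Γ A B: arguments M₁ … Mₙ over Γ such that L M₁ … Mₙ has type B when L
-- has type A.
data Args (Γ : Ctx) : Type → Type → Set where
  []  : ∀ {A} → Args Γ A A
  _∷_ : ∀ {A B C} → Γ ⊢ A → Args Γ B C → Args Γ (A ⇒ B) C

weakenArgs : ∀ {Γ A B C} → Args Γ A B → Args (C ∷ Γ) A B
weakenArgs []       = []
weakenArgs (M ∷ Ms) = rename there M ∷ weakenArgs Ms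

-- PrimeRedexOf L Ms x N: the term L applied to Ms has a prime redex (λx , N).
-- Both the variable x bound by that λ and the argument N are given in the
-- context of the head occurrence; the renaming of N to that context is the
-- one that makes M[N/x₀] capture-avoiding.  The constructor app only moves an
-- argument of the term into Ms; the other three are the clauses for abstractions.
data PrimeRedexOf : ∀ {Γ A B} (L : Γ ⊢ A) → Args Γ A B →
                    ∀ {C} → C ∈ headCtx L → headCtx L ⊢ C → Set where
  app   : ∀ {Γ A B C D} {L : Γ ⊢ A ⇒ B} {M : Γ ⊢ A} {Ms : Args Γ B D}
          {x : C ∈ headCtx L} {N : headCtx L ⊢ C} →
          PrimeRedexOf L (M ∷ Ms) x N → PrimeRedexOf (L · M) Ms x N
  under : ∀ {Γ A B C} {L : A ∷ Γ ⊢ B} {x : C ∈ headCtx L} {N : headCtx L ⊢ C} →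
          PrimeRedexOf L [] x N → PrimeRedexOf (ƛ L) [] x N
  first : ∀ {Γ A B D} {L : A ∷ Γ ⊢ B} {M : Γ ⊢ A} {Ms : Args Γ B D} →
          PrimeRedexOf (ƛ L) (M ∷ Ms) (toHead L (here refl)) (rename (toHead (ƛ L)) M)
  later : ∀ {Γ A B C D} {L : A ∷ Γ ⊢ B} {M : Γ ⊢ A} {Ms : Args Γ B D}
          {x : C ∈ headCtx L} {N : headCtx L ⊢ C} →
          PrimeRedexOf L (weakenArgs Ms) x N → PrimeRedexOf (ƛ L) (M ∷ Ms) x N

infix 4 _→lhr_

data _→lhr_ {Γ A} (M : Γ ⊢ A) : Γ ⊢ A → Set where
  lhr : ∀ {x N} → headVar M ≡ just x → PrimeRedexOf M [] x N → M →lhr replaceHead M N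

-- 𝒩 M k: the reduction sequence from M ends after exactly k steps.
data 𝒩 {Γ A} (M : Γ ⊢ A) : ℕ → Set where
  stop : (∀ {M′} → ¬ (M →lhr M′)) → 𝒩 M 0
  step : ∀ {M′ k} → M →lhr M′ → 𝒩 M′ k → 𝒩 M (suc k)

-- Renaming N to the head context (see PrimeRedexOf) does not affect whether
-- it is closed.
StronglyLocallyScoped : ∀ {Γ A} → Γ ⊢ A → Set
StronglyLocallyScoped M =
  ∀ {Δ B} {P : Δ ⊢ B} → P SubtermOf M →
  ∀ {C} {x : C ∈ headCtx P} {N : headCtx P ⊢ C} → PrimeRedexOf P [] x N → Closed N

maximum : ℕ → List ℕ → ℕ
maximum = foldr _⊔_

-- depthApp L ds is the depth of L M₁ … Mₙ, where ds lists the depths of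
-- M₁, …, Mₙ.  Depths are invariant under weakening, so they can be computed
-- before the arguments are moved under binders.  As every depth is at least
-- 1, the default 1 in the variable clause matters only for n = 0.
depthApp : ∀ {Γ A} → Γ ⊢ A → List ℕ → ℕ
depthApp ∗       ds       = 1
depthApp (var x) ds       = maximum 1 ds
depthApp (ƛ L)   []       = depthApp L []
depthApp (ƛ L)   (d ∷ ds) = depthApp L ds ⊔ suc d
depthApp (L · M) ds       = depthApp L (depthApp M [] ∷ ds)

depth : ∀ {Γ A} → Γ ⊢ A → ℕ
depth M = depthApp M []

-- The same scheme for the local height.
lhApp : ∀ {Γ A} → Γ ⊢ A → List ℕ → ℕ
lhApp ∗       hs       = 0
lhApp (var x) hs       = suc (maximum 0 hs)
lhApp (ƛ L)   []       = lhApp L []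
lhApp (ƛ L)   (h ∷ hs) = lhApp L hs ⊔ h
lhApp (L · M) hs       = lhApp L (lhApp M [] ∷ hs)

lh : ∀ {Γ A} → Γ ⊢ A → ℕ
lh M = lhApp M []

record Admissible (n h d : ℕ) {Γ A} (M : Γ ⊢ A) : Set where
  field
    scoped  : StronglyLocallyScoped M
    ord≤    : ord M ≤ n
    lh≤     : lh M ≤ h
    depth≤  : depth M ≤ d

-- L n h d m: the maximum defining Lₙ(h, d) exists and equals m.
L : (n h d m : ℕ) → Set
L n h d m =
  (∃[ Γ ] ∃[ A ] Σ[ M ∈ Γ ⊢ A ] Admissible n h d M × 𝒩 M m) ×
  (∀ {Γ A} (M : Γ ⊢ A) → Admissible n h d M → ∃[ k ] 𝒩 M k × k ≤ m)

-- A nonnegative real r, given by its closed rational cuts: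
-- lower a b says a/b ≤ r, and upper a b says r ≤ a/b.
record ℝ⁺ : Set₁ where
  field
    lower : (a b : ℕ) → .{{NonZero b}} → Set
    upper : (a b : ℕ) → .{{NonZero b}} → Set
open ℝ⁺ public

-- By continuity of 2^_, a/b ≤ 2^r iff a/b ≤ 2^(s/t) for all s/t ≥ r, and dually.
2^ : ℝ⁺ → ℝ⁺
2^ r .lower a b = ∀ s t → .{{_ : NonZero t}} → upper r s t → a ^ t ≤ 2 ^ s * b ^ t
2^ r .upper a b = ∀ s t → .{{_ : NonZero t}} → lower r s t → 2 ^ s * b ^ t ≤ a ^ t

tower : ℕ → ℝ⁺ → ℝ⁺
tower zero    r = r
tower (suc k) r = 2^ (tower k r)

-- For c = p/q > 0 and h ≥ 1: a/b ≤ c·d·log h iff 2^(a·q) ≤ h^(p·d·b), and dually.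
_·_·log_ : ℚᵘ → ℕ → ℕ → ℝ⁺
(c · d ·log h) .lower a b = 2 ^ (a * ↧ₙ c) ≤ h ^ (∣ ↥ c ∣ * d * b)
(c · d ·log h) .upper a b = h ^ (∣ ↥ c ∣ * d * b) ≤ 2 ^ (a * ↧ₙ c)

infix 4 _≤ℝ_ _ℝ≤_

_≤ℝ_ : ℕ → ℝ⁺ → Set
m ≤ℝ r = lower r m 1

_ℝ≤_ : ℝ⁺ → ℕ → Set
r ℝ≤ m = upper r m 1

{-# OPTIONS --safe #-}
module Submission where

-- Linear head reduction is counted by a denotational semantics: a term of type
-- o denotes the number of its reduction steps, and an argument gains one unit of
-- cost (tick) when it is passed, to be paid whenever its variable reaches the
-- head.  A step lowers the denotation by exactly 1, so 𝒩(M) is the denotation.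
--
-- Upper bound.  A world gives for each level k a number w k bounding the
-- variables of level k.  Without redexes, a term of local height h has cost at
-- most t₀, where t_{n} = 2h, t_k = (w k + 2)^t_{k+1} for k ≥ 2,
-- t₁ = (w 1 + 2) t₂ and t₀ = w 0 + t₁.  Strong local scope makes the arguments
-- of redexes closed, so that they can be bounded on their own, and the tiers t_k
-- obtained for depth d form the world used for depth d + 1.  On the top level
-- n - 1 the d iterations multiply d heights, which gives h^O(d) below the
-- exponentials contributed by the other levels.
--
-- Lower bound.  Applying d times the numeral g ↦ g^h to a function of level n - 1,
-- which is closed at every stage, yields a function of cost h^d if n = 2 and the
-- numeral 2^(h^d) if n ≥ 3; applying the latter to the numerals 2 of the levels
-- n - 2, …, 2 adds n - 3 further exponentials.

open import Defs
open import Data.Empty using (⊥-elim)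
import Data.Integer as ℤ
open import Data.List using (List; []; _∷_; _++_)
open import Data.List.Membership.Propositional using (_∈_)
open import Data.List.Relation.Binary.Subset.Propositional using (_⊆_)
open import Data.List.Relation.Binary.Subset.Propositional.Properties using (∷⁺ʳ)
open import Data.List.Relation.Unary.Any using (here; there)
open import Data.Maybe using (just)
open import Data.Nat
open import Data.Nat.Properties
open import Data.Nat.Solver using (module +-*-Solver)
open import Data.Product using (Σ-syntax; ∃-syntax; _×_; _,_; proj₁; proj₂)
open import Data.Rational.Unnormalised using (ℚᵘ; mkℚᵘ; Positive)
open import Data.Sum using (_⊎_; inj₁; inj₂)
open import Data.Unit using (⊤; tt)
open import Function using (_∘_)
open import Relation.Binary.PropositionalEquality
open import Relation.Nullary using (¬_; yes; no)
open +-*-Solver using (solve; _:+_; _:*_; _:=_; con)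

-- Costs of linear head reduction

⟦_⟧ : Type → Set
⟦ o ⟧     = ℕ
⟦ A ⇒ B ⟧ = ⟦ A ⟧ → ⟦ B ⟧

Env : Ctx → Set
Env Γ = ∀ {A} → A ∈ Γ → ⟦ A ⟧

infixl 5 _▸_

_▸_ : ∀ {Γ A} → Env Γ → ⟦ A ⟧ → Env (A ∷ Γ)
(γ ▸ v) (here refl) = v
(γ ▸ v) (there x)   = γ x

tick : ∀ A → ⟦ A ⟧ → ⟦ A ⟧
tick o       m   = suc m
tick (A ⇒ B) f a = tick B (f a)

null : ∀ A → ⟦ A ⟧
null o         = 0
null (A ⇒ B) _ = null B

eval : ∀ {Γ A} → Γ ⊢ A → Env Γ → ⟦ A ⟧
eval (var x) γ         = γ x
eval (ƛ M)   γ v       = eval M (γ ▸ v)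
eval (_·_ {A} M N) γ   = eval M γ (tick A (eval N γ))
eval (∗ {A}) γ         = null A

-- Every type ends in `o`, so a value together with a full stack of arguments yields a number; costs
-- at higher types are compared in this way.
Stack : Type → Set
Stack o       = ⊤
Stack (A ⇒ B) = ⟦ A ⟧ × Stack B

run : ∀ A → ⟦ A ⟧ → Stack A → ℕ
run o       m _       = m
run (A ⇒ B) f (v , s) = run B (f v) s

nulls : ∀ A → Stack A
nulls o       = tt
nulls (A ⇒ B) = null A , nulls B

nullEnv : ∀ {Γ} → Env Γ
nullEnv {A = A} _ = null A

-- Reduction stops at a head variable that is free or whose abstraction lacks an argument; such
-- variables therefore denote `null`, like constants.
cost : ∀ {Γ A} → Γ ⊢ A → ℕ
cost {A = A} M = run A (eval M nullEnv) (nulls A)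

run-tick : ∀ A v s → run A (tick A v) s ≡ suc (run A v s)
run-tick o       v s       = refl
run-tick (A ⇒ B) f (v , s) = run-tick B (f v) s

run-null : ∀ A s → run A (null A) s ≡ 0
run-null o       s       = refl
run-null (A ⇒ B) (v , s) = run-null B s

-- Replaces equality of denotations, as function extensionality is not available.
_≈_ : ∀ {A} → ⟦ A ⟧ → ⟦ A ⟧ → Set
_≈_ {o}     m n = m ≡ n
_≈_ {A ⇒ B} f g = ∀ {u v} → u ≈ v → f u ≈ g v

≈-sym : ∀ A {u v : ⟦ A ⟧} → u ≈ v → v ≈ u
≈-sym o       p   = sym p
≈-sym (A ⇒ B) p q = ≈-sym B (p (≈-sym A q))

≈-trans : ∀ A {u v w : ⟦ A ⟧} → u ≈ v → v ≈ w → u ≈ w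
≈-trans o       p q   = trans p q
≈-trans (A ⇒ B) p q r = ≈-trans B (p r) (q (≈-trans A (≈-sym A r) r))

tick-cong : ∀ A {u v : ⟦ A ⟧} → u ≈ v → tick A u ≈ tick A v
tick-cong o       p   = cong suc p
tick-cong (A ⇒ B) p q = tick-cong B (p q)

null-≈ : ∀ A → null A ≈ null A
null-≈ o         = refl
null-≈ (A ⇒ B) _ = null-≈ B

_≈ₑ_ : ∀ {Γ} → Env Γ → Env Γ → Set
_≈ₑ_ {Γ} γ δ = ∀ {A} (x : A ∈ Γ) → γ x ≈ δ x

▸-cong : ∀ {Γ A} {γ δ : Env Γ} {u v : ⟦ A ⟧} → γ ≈ₑ δ → u ≈ v → (_▸_ {A = A} γ u) ≈ₑ (δ ▸ v)
▸-cong p q (here refl) = q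
▸-cong p q (there x)   = p x

eval-cong : ∀ {Γ A} (M : Γ ⊢ A) {γ δ : Env Γ} → γ ≈ₑ δ → eval M γ ≈ eval M δ
eval-cong (var x) p   = p x
eval-cong (ƛ M)   {γ} {δ} p q = eval-cong M (▸-cong {γ = γ} {δ} p q)
eval-cong (_·_ {A} M N) p = eval-cong M p (tick-cong A (eval-cong N p))
eval-cong (∗ {A}) p   = null-≈ A

eval-rename : ∀ {Γ Δ A} (M : Γ ⊢ A) (ρ : Γ ⊆ Δ) {γ : Env Γ} {δ : Env Δ} →
              (∀ {B} (x : B ∈ Γ) → γ x ≈ δ (ρ x)) → eval M γ ≈ eval (rename ρ M) δ
eval-rename (var x) ρ p   = p x
eval-rename (ƛ {A} M) ρ {γ} {δ} p {u} {v} q = eval-rename M (∷⁺ʳ A ρ) λ where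
  (here refl) → q
  (there x)   → p x
eval-rename (_·_ {A} M N) ρ p = eval-rename M ρ p (tick-cong A (eval-rename N ρ p))
eval-rename (∗ {A}) ρ p   = null-≈ A

data _≈ₛ_ : ∀ {A} → Stack A → Stack A → Set where
  []  : tt ≈ₛ tt
  _∷_ : ∀ {A B} {u v : ⟦ A ⟧} {s t : Stack B} → u ≈ v → s ≈ₛ t → _≈ₛ_ {A ⇒ B} (u , s) (v , t)

run-cong : ∀ {A} {u v : ⟦ A ⟧} {s t : Stack A} → u ≈ v → s ≈ₛ t → run A u s ≡ run A v t
run-cong p []      = p
run-cong p (q ∷ r) = run-cong (p q) r

nulls-≈ : ∀ A → nulls A ≈ₛ nulls A
nulls-≈ o       = []
nulls-≈ (A ⇒ B) = null-≈ A ∷ nulls-≈ B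

-- Environment and stack at the head occurrence, as in Krivine's machine

headEnv : ∀ {Γ A} (L : Γ ⊢ A) → Env Γ → Stack A → Env (headCtx L)
headEnv (var x)       γ s       = γ
headEnv (ƛ L)         γ (v , s) = headEnv L (γ ▸ v) s
headEnv (_·_ {A} L M) γ s       = headEnv L γ (tick A (eval M γ) , s)
headEnv ∗             γ s       = γ

headStack : ∀ {Γ A} (L : Γ ⊢ A) → Env Γ → Stack A → Stack (headType L)
headStack (var x)       γ s       = s
headStack (ƛ L)         γ (v , s) = headStack L (γ ▸ v) s
headStack (_·_ {A} L M) γ s       = headStack L γ (tick A (eval M γ) , s)
headStack ∗             γ s       = s

run-head : ∀ {Γ A} (L : Γ ⊢ A) {γ : Env Γ} {s x} → headVar L ≡ just x →
           run A (eval L γ) s ≡ run (headType L) (headEnv L γ s x) (headStack L γ s)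
run-head (var x) refl             = refl
run-head (ƛ L)   {s = v , s} p    = run-head L p
run-head (L · M) p                = run-head L p

-- Replacing the head leaves the path to it unchanged, hence also the environment and the stack that
-- reach it.
run-replaceHead : ∀ {Γ A} (L : Γ ⊢ A) {γ : Env Γ} {s} P →
  run A (eval (replaceHead L P) γ) s ≡ run (headType L) (eval P (headEnv L γ s)) (headStack L γ s)
run-replaceHead (var x) P             = refl
run-replaceHead (ƛ L) {s = v , s} P   = run-replaceHead L P
run-replaceHead (L · M) P             = run-replaceHead L P
run-replaceHead ∗ P                   = refl

headEnv-toHead : ∀ {Γ A} (L : Γ ⊢ A) {γ : Env Γ} {s} {B} (x : B ∈ Γ) → headEnv L γ s (toHead L x) ≡ γ x
headEnv-toHead (var y) x             = refl
headEnv-toHead (ƛ L) {s = v , s} x   = headEnv-toHead L (there x)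
headEnv-toHead (L · M) x             = headEnv-toHead L x
headEnv-toHead ∗ x                   = refl

headStack-≈ : ∀ {Γ A} (L : Γ ⊢ A) {γ : Env Γ} {s} → γ ≈ₑ γ → s ≈ₛ s →
              headStack L γ s ≈ₛ headStack L γ s
headStack-≈ (var x) p q = q
headStack-≈ (ƛ L) {γ} p (q ∷ r) = headStack-≈ L (▸-cong {γ = γ} {γ} p q) r
headStack-≈ (_·_ {A} L M) p q = headStack-≈ L p (tick-cong A (eval-cong M p) ∷ q)
headStack-≈ ∗ p q = q

data Holds {Γ} (γ : Env Γ) : ∀ {A B} → Args Γ A B → Stack A → Set where
  []  : ∀ {A} {s : Stack A} → Holds γ [] s
  _∷_ : ∀ {A B C} {M : Γ ⊢ A} {Ms : Args Γ B C} {v : ⟦ A ⟧} {s : Stack B} →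
        v ≈ tick A (eval M γ) → Holds γ Ms s → Holds γ (M ∷ Ms) (v , s)

Holds-weaken : ∀ {Γ A B C} {γ : Env Γ} {Ms : Args Γ A B} {s v} → γ ≈ₑ γ →
               Holds γ Ms s → Holds (_▸_ {A = C} γ v) (weakenArgs Ms) s
Holds-weaken p []                 = []
Holds-weaken {γ = γ} p (_∷_ {A} {M = M} q r) =
  ≈-trans A q (tick-cong A (eval-rename M there p)) ∷ Holds-weaken p r

-- The abstraction of a prime redex meets on the stack the value of its own argument, ticked when it
-- was passed; moving the argument under binders does not change its value.
prime-value : ∀ {Γ A B C} {L : Γ ⊢ A} {Ms : Args Γ A B} {x : C ∈ headCtx L} {N} →
              PrimeRedexOf L Ms x N → ∀ {γ : Env Γ} {s} → γ ≈ₑ γ → s ≈ₛ s → Holds γ Ms s →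
              headEnv L γ s x ≈ tick C (eval N (headEnv L γ s))
prime-value (app {A = A} {M = M} r) p q h =
  prime-value r p (v ∷ q) (v ∷ h)
  where v = tick-cong A (eval-cong M p)
prime-value (under r) {γ} p (q ∷ t) [] = prime-value r (▸-cong {γ = γ} {γ} p q) t []
prime-value (first {A = A} {L = L} {M = M}) {γ} {v , s} p (q ∷ t) (e ∷ h)
  rewrite headEnv-toHead L {γ ▸ v} {s} (here refl) =
  ≈-trans A e (tick-cong A (eval-rename M (toHead (ƛ L)) λ x →
    subst (γ x ≈_) (sym (headEnv-toHead L (there x))) (p x)))
prime-value (later r) {γ} p (q ∷ t) (e ∷ h) =
  prime-value r (▸-cong {γ = γ} {γ} p q) t (Holds-weaken p h)

-- The head variable denotes the ticked value of `N`, so putting `N` in its place loses exactly the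
-- tick.
cost-step : ∀ {Γ A} {M M′ : Γ ⊢ A} → M →lhr M′ → cost M ≡ suc (cost M′)
cost-step {A = A} {M} (lhr {x} {N} p r) = begin
  cost M                            ≡⟨ run-head M p ⟩
  run _ (ρ x) t                     ≡⟨ run-cong (prime-value r null-≈ₑ (nulls-≈ A) [])
                                         (headStack-≈ M {nullEnv} null-≈ₑ (nulls-≈ A)) ⟩
  run _ (tick _ (eval N ρ)) t       ≡⟨ run-tick _ (eval N ρ) t ⟩
  suc (run _ (eval N ρ) t)          ≡⟨ cong suc (sym (run-replaceHead M N)) ⟩
  suc (cost (replaceHead M N))      ∎
  where
    open ≡-Reasoning
    ρ = λ {A} → headEnv M nullEnv (nulls _) {A}
    t = headStack M nullEnv (nulls A)
    null-≈ₑ : nullEnv ≈ₑ nullEnv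
    null-≈ₑ {A} _ = null-≈ A

-- Progress: a positive cost yields a step

data HeadStatus {Γ A B} (L : Γ ⊢ A) (Ms : Args Γ A B) (γ : Env Γ) (s : Stack A) : Set where
  blocked : run A (eval L γ) s ≡ 0 → HeadStatus L Ms γ s
  redex   : ∀ {x N} → headVar L ≡ just x → PrimeRedexOf L Ms x N → HeadStatus L Ms γ s
  older   : ∀ (x : headType L ∈ Γ) → headVar L ≡ just (toHead L x) → HeadStatus L Ms γ s

-- Beyond the values that stand for `Ms` the stack is null, so an abstraction without an argument
-- binds `null`.
data TrailingNulls {Γ} : ∀ {A B} → Args Γ A B → Stack A → Set where
  []  : ∀ {A} → TrailingNulls [] (nulls A)
  _∷_ : ∀ {A B C} {Ms : Args Γ B C} {s : Stack B} M (v : ⟦ A ⟧) → TrailingNulls Ms s →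
        TrailingNulls (M ∷ Ms) (v , s)

TrailingNulls-weaken : ∀ {Γ A B C} {Ms : Args Γ A B} {s} → TrailingNulls Ms s → TrailingNulls (weakenArgs {C = C} Ms) s
TrailingNulls-weaken []            = []
TrailingNulls-weaken ((M ∷ v) h)   = (rename there M ∷ v) (TrailingNulls-weaken h)

null-or-older : ∀ {Γ A C} {γ : Env Γ} (x : C ∈ A ∷ Γ) →
                (∀ s → run C ((_▸_ {A = A} γ (null A)) x) s ≡ 0) ⊎ Σ[ y ∈ C ∈ Γ ] x ≡ there y
null-or-older (here refl) = inj₁ (run-null _)
null-or-older (there x)   = inj₂ (x , refl)

redex-or-older : ∀ {Γ A B C D} {L : A ∷ Γ ⊢ B} {M : Γ ⊢ A} {Ms : Args Γ B D}
                 (x : C ∈ A ∷ Γ) → (∃[ N ] PrimeRedexOf (ƛ L) (M ∷ Ms) (toHead L x) N) ⊎ Σ[ y ∈ C ∈ Γ ] x ≡ there y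
redex-or-older (here refl) = inj₁ (_ , first)
redex-or-older (there x)   = inj₂ (x , refl)

-- In the case `older` the head variable is not bound on the path inside `L`; each abstraction
-- further out either binds it, which decides between a redex and cost 0, or passes it on.
headStatus : ∀ {Γ A B} (L : Γ ⊢ A) (Ms : Args Γ A B) (γ : Env Γ) {s} →
             TrailingNulls Ms s → HeadStatus L Ms γ s
headStatus (var x) Ms γ h = older x refl
headStatus (∗ {A}) Ms γ {s} h = blocked (run-null A s)
headStatus (_·_ {A} L M) Ms γ h with headStatus L (M ∷ Ms) γ ((M ∷ tick A (eval M γ)) h)
... | blocked p = blocked p
... | redex p r = redex p (app r)
... | older x p = older x p
headStatus (ƛ {A} L) [] γ [] with headStatus L [] (γ ▸ null A) []
... | blocked p          = blocked p
... | redex p r          = redex p (under r)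
... | older x p with null-or-older {γ = γ} x
...   | inj₁ q          = blocked (trans (run-head L p)
                            (trans (cong (λ v → run _ v _) (headEnv-toHead L x)) (q _)))
...   | inj₂ (y , refl) = older y p
headStatus (ƛ L) (M ∷ Ms) γ ((M ∷ v) h) with headStatus L (weakenArgs Ms) (γ ▸ v) (TrailingNulls-weaken h)
... | blocked p          = blocked p
... | redex p r          = redex p (later r)
... | older x p with redex-or-older {L = L} {M} {Ms} x
...   | inj₁ (_ , r)    = redex p r
...   | inj₂ (y , refl) = older y p

cost-progress : ∀ {Γ A} (M : Γ ⊢ A) {k} → cost M ≡ suc k → ∃[ M′ ] M →lhr M′
cost-progress M p with headStatus M [] nullEnv []
... | blocked q with () ← trans (sym q) p
... | redex q r = _ , lhr q r
... | older x q with () ← trans (sym (trans (run-head M q)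
        (trans (cong (λ v → run _ v _) (headEnv-toHead M x)) (run-null (headType M) _)))) p

-- Induction on the cost: this gives termination and the exact length at once.
𝒩-cost : ∀ {Γ A} (M : Γ ⊢ A) → 𝒩 M (cost M)
𝒩-cost M = go M (cost M) refl
  where
    go : ∀ {Γ A} (M : Γ ⊢ A) k → cost M ≡ k → 𝒩 M k
    go M zero    p = stop λ r → 0≢1+n (trans (sym p) (cost-step r))
    go M (suc k) p with M′ , r ← cost-progress M p =
      step r (go M′ k (suc-injective (trans (sym (cost-step r)) p)))

𝒩-unique : ∀ {Γ A} {M : Γ ⊢ A} {k} → 𝒩 M k → k ≡ cost M
𝒩-unique {M = M} (stop p) with cost M in eq
... | zero  = refl
... | suc k = ⊥-elim (p (proj₂ (cost-progress M eq)))
𝒩-unique (step r n) = trans (cong suc (𝒩-unique n)) (sym (cost-step r))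

-- Strong local scope

FreeIn-rename : ∀ {Γ Δ A B} {M : Γ ⊢ B} (ρ : Γ ⊆ Δ) {x : A ∈ Γ} → x FreeIn M → ρ x FreeIn rename ρ M
FreeIn-rename ρ var      = var
FreeIn-rename ρ (ƛ p)    = ƛ (FreeIn-rename (∷⁺ʳ _ ρ) p)
FreeIn-rename ρ (appˡ p) = appˡ (FreeIn-rename ρ p)
FreeIn-rename ρ (appʳ p) = appʳ (FreeIn-rename ρ p)

FreeIn-rename⁻ : ∀ {Γ Δ A B} (M : Γ ⊢ B) (ρ : Γ ⊆ Δ) {y : A ∈ Δ} →
                 y FreeIn rename ρ M → Σ[ x ∈ A ∈ Γ ] ρ x ≡ y × x FreeIn M
FreeIn-rename⁻ (var x) ρ var = x , refl , var
FreeIn-rename⁻ (ƛ M) ρ (ƛ p) with FreeIn-rename⁻ M (∷⁺ʳ _ ρ) p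
... | there x , refl , q = x , refl , ƛ q
FreeIn-rename⁻ (M · N) ρ (appˡ p) with x , e , q ← FreeIn-rename⁻ M ρ p = x , e , appˡ q
FreeIn-rename⁻ (M · N) ρ (appʳ p) with x , e , q ← FreeIn-rename⁻ N ρ p = x , e , appʳ q

Closed-rename : ∀ {Γ Δ A} (M : Γ ⊢ A) (ρ : Γ ⊆ Δ) → Closed M → Closed (rename ρ M)
Closed-rename M ρ c y p with x , _ , q ← FreeIn-rename⁻ M ρ p = c x q

Closed-rename⁻ : ∀ {Γ Δ A} (M : Γ ⊢ A) (ρ : Γ ⊆ Δ) → Closed (rename ρ M) → Closed M
Closed-rename⁻ M ρ c x p = c (ρ x) (FreeIn-rename ρ p)

-- Strong local scope in the style of depthApp: cs lists, for the arguments
-- M₁, …, Mₙ of L, the propositions that they are closed.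
Scoped : ∀ {Γ A} → Γ ⊢ A → List Set → Set
Scoped ∗       cs       = ⊤
Scoped (var x) cs       = ⊤
Scoped (ƛ L)   []       = Scoped L []
Scoped (ƛ L)   (c ∷ cs) = c × Scoped L cs
Scoped (L · M) cs       = Scoped M [] × Scoped L (Closed M ∷ cs)

-- The arguments are weakened along the path while the list of propositions stays fixed. Closedness
-- before and after weakening is equivalent but not the same proposition, so implications are
-- recorded, one relation for each direction.
data ArgsClosed⇒ {Γ} : ∀ {A B} → Args Γ A B → List Set → Set₁ where
  []  : ∀ {A} → ArgsClosed⇒ ([] {A = A}) []
  _∷_ : ∀ {A B C} {M : Γ ⊢ A} {Ms : Args Γ B C} {c cs} →
        (Closed M → c) → ArgsClosed⇒ Ms cs → ArgsClosed⇒ (M ∷ Ms) (c ∷ cs)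

data ⇒ArgsClosed {Γ} : ∀ {A B} → List Set → Args Γ A B → Set₁ where
  []  : ∀ {A} → ⇒ArgsClosed [] ([] {A = A})
  _∷_ : ∀ {A B C} {M : Γ ⊢ A} {Ms : Args Γ B C} {c cs} →
        (c → Closed M) → ⇒ArgsClosed cs Ms → ⇒ArgsClosed (c ∷ cs) (M ∷ Ms)

ArgsClosed⇒-weaken : ∀ {Γ A B C} {Ms : Args Γ A B} {cs} →
                     ArgsClosed⇒ Ms cs → ArgsClosed⇒ (weakenArgs {C = C} Ms) cs
ArgsClosed⇒-weaken []      = []
ArgsClosed⇒-weaken (p ∷ q) = (p ∘ Closed-rename⁻ _ there) ∷ ArgsClosed⇒-weaken q

⇒ArgsClosed-weaken : ∀ {Γ A B C} {Ms : Args Γ A B} {cs} →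
                     ⇒ArgsClosed cs Ms → ⇒ArgsClosed cs (weakenArgs {C = C} Ms)
⇒ArgsClosed-weaken []      = []
⇒ArgsClosed-weaken (p ∷ q) = (Closed-rename _ there ∘ p) ∷ ⇒ArgsClosed-weaken q

PrimeClosed : ∀ {Γ A B} → Γ ⊢ A → Args Γ A B → Set
PrimeClosed L Ms = ∀ {C} {x : C ∈ headCtx L} {N} → PrimeRedexOf L Ms x N → Closed N

scoped⁺ : ∀ {Γ A B} (L : Γ ⊢ A) {Ms : Args Γ A B} {cs} → ArgsClosed⇒ Ms cs → PrimeClosed L Ms →
          (∀ {Δ C} {P : Δ ⊢ C} → P SubtermOf L → PrimeClosed P []) → Scoped L cs
scoped⁺ (var x) cl p q = tt
scoped⁺ ∗       cl p q = tt
scoped⁺ (ƛ L) [] p q = scoped⁺ L [] (λ r → p (under r)) (λ s → q (ƛ s))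
scoped⁺ (ƛ L) {M ∷ Ms} (c ∷ cl) p q =
  c (Closed-rename⁻ M (toHead (ƛ L)) (p first)) ,
  scoped⁺ L (ArgsClosed⇒-weaken cl) (λ r → p (later r)) (λ s → q (ƛ s))
scoped⁺ (L · M) cl p q =
  scoped⁺ M [] (q (appʳ self)) (λ s → q (appʳ s)) ,
  scoped⁺ L (_∷_ {c = Closed M} (λ c → c) cl) (λ r → p (app r)) (λ s → q (appˡ s))

StronglyLocallyScoped⇒Scoped : ∀ {Γ A} (M : Γ ⊢ A) → StronglyLocallyScoped M → Scoped M []
StronglyLocallyScoped⇒Scoped M p = scoped⁺ M [] (p self) (λ s → p s)

Scoped-prime : ∀ {Γ A B C} {L : Γ ⊢ A} {Ms : Args Γ A B} {cs} {x : C ∈ headCtx L} {N} →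
               PrimeRedexOf L Ms x N → ⇒ArgsClosed cs Ms → Scoped L cs → Closed N
Scoped-prime (app {M = M} r) cl (_ , p) = Scoped-prime r (_∷_ {c = Closed M} (λ c → c) cl) p
Scoped-prime (under r) []      p       = Scoped-prime r [] p
Scoped-prime (first {L = L} {M}) (c ∷ cl) (p , _) = Closed-rename M (toHead (ƛ L)) (c p)
Scoped-prime (later r) (c ∷ cl) (_ , p) = Scoped-prime r (⇒ArgsClosed-weaken cl) p

-- Dropping trailing arguments only removes redexes. This serves the function part of an
-- application, which as a subterm stands without its argument.
Scoped-prefix : ∀ {Γ A} (L : Γ ⊢ A) cs {cs′} → Scoped L (cs ++ cs′) → Scoped L cs
Scoped-prefix ∗       cs       p       = tt
Scoped-prefix (var x) cs       p       = tt
Scoped-prefix (ƛ L)   []       {[]} p  = p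
Scoped-prefix (ƛ L)   []       {_ ∷ _} (_ , p) = Scoped-prefix L [] p
Scoped-prefix (ƛ L)   (c ∷ cs) (q , p) = q , Scoped-prefix L cs p
Scoped-prefix (L · M) cs       (q , p) = q , Scoped-prefix L (Closed M ∷ cs) p

Scoped-subterm : ∀ {Γ Δ A B} {M : Γ ⊢ A} {P : Δ ⊢ B} → P SubtermOf M → Scoped M [] → Scoped P []
Scoped-subterm self     p       = p
Scoped-subterm (ƛ s)    p       = Scoped-subterm s p
Scoped-subterm (appˡ {M = M} s) (_ , p) = Scoped-subterm s (Scoped-prefix M [] p)
Scoped-subterm (appʳ s) (p , _) = Scoped-subterm s p

Scoped⇒StronglyLocallyScoped : ∀ {Γ A} (M : Γ ⊢ A) → Scoped M [] → StronglyLocallyScoped M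
Scoped⇒StronglyLocallyScoped M p s r = Scoped-prime r [] (Scoped-subterm s p)

-- Worlds and tiers

World : Set
World = ℕ → ℕ

-- The step from t_{k+1} to t_k. Adding 2 to the base makes it strictly increasing in `t`, also for
-- `a = 0`.
grow : ℕ → ℕ → ℕ → ℕ
grow 0             a t = a + t
grow 1             a t = (2 + a) * t
grow (suc (suc _)) a t = (2 + a) ^ t

-- With p = 2h and K = n - 1, descend (suc K) w p is the number t₀ of the header
-- and tier K w p j is t_j.
descend : ℕ → World → ℕ → ℕ
descend zero    w p = p
descend (suc k) w p = descend k w (grow k (w k) p)

climb : ℕ → World → ℕ → ℕ → ℕ
climb zero    w p j = p
climb (suc i) w p j = grow j (w j) (climb i w p (suc j))

tier : ℕ → World → ℕ → ℕ → ℕ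
tier K w p j = climb (suc K ∸ j) w p j

1≤[2+a]^t : ∀ a t → 1 ≤ (2 + a) ^ t
1≤[2+a]^t a t = m^n>0 (2 + a) t

n<[2+a]^n : ∀ a n → n < (2 + a) ^ n
n<[2+a]^n a zero    = s≤s z≤n
n<[2+a]^n a (suc n) = begin-strict
  suc n                             ≤⟨ n<[2+a]^n a n ⟩
  (2 + a) ^ n                       ≡⟨ sym (+-identityʳ _) ⟩
  (2 + a) ^ n + 0                   <⟨ +-monoʳ-< ((2 + a) ^ n) (≤-trans (1≤[2+a]^t a n) (m≤m+n _ _)) ⟩
  (2 + a) ^ n + (suc a) * (2 + a) ^ n   ∎
  where open ≤-Reasoning

grow-mono : ∀ k {a b t u} → a ≤ b → t ≤ u → grow k a t ≤ grow k b u
grow-mono 0             p q = +-mono-≤ p q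
grow-mono 1             p q = *-mono-≤ (+-monoʳ-≤ 2 p) q
grow-mono (suc (suc _)) {a} {b} {t} {u} p q =
  ≤-trans (^-monoˡ-≤ t (+-monoʳ-≤ 2 p)) (^-monoʳ-≤ (2 + b) q)

grow-monoʳ-< : ∀ k {a t u} → t < u → grow k a t < grow k a u
grow-monoʳ-< 0             {a} p = +-monoʳ-< a p
grow-monoʳ-< 1             {a} p = *-monoʳ-< (2 + a) p
grow-monoʳ-< (suc (suc _)) {a} p = ^-monoʳ-< (2 + a) (s≤s (s≤s z≤n)) p

grow-increasing : ∀ k a t → t ≤ grow k a t
grow-increasing 0             a t = m≤n+m t a
grow-increasing 1             a t = m≤n*m t (2 + a)
grow-increasing (suc (suc _)) a t = <⇒≤ (n<[2+a]^n a t)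

grow-base : ∀ k a {t} → 1 ≤ t → a ≤ grow k a t
grow-base 0             a {t} p = m≤m+n a t
grow-base 1             a {suc t} p = ≤-trans (m≤n+m a 2) (m≤m*n (2 + a) (suc t))
grow-base (suc (suc _)) a {suc t} p =
  ≤-trans (m≤n+m a 2) (m≤m*n (2 + a) ((2 + a) ^ t) {{>-nonZero (1≤[2+a]^t a t)}})

descend-mono : ∀ k {w w′ p p′} → (∀ {i} → i < k → w i ≤ w′ i) → p ≤ p′ → descend k w p ≤ descend k w′ p′
descend-mono zero    f q = q
descend-mono (suc k) f q = descend-mono k (λ l → f (m<n⇒m<1+n l)) (grow-mono k (f ≤-refl) q)

descend-monoʳ-< : ∀ k {w p p′} → p < p′ → descend k w p < descend k w p′
descend-monoʳ-< zero    q = q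
descend-monoʳ-< (suc k) q = descend-monoʳ-< k (grow-monoʳ-< k q)

climb-mono : ∀ i {w w′ p j} → (∀ {l} → j ≤ l → w l ≤ w′ l) → climb i w p j ≤ climb i w′ p j
climb-mono zero    f = ≤-refl
climb-mono (suc i) {j = j} f = grow-mono j (f ≤-refl) (climb-mono i (λ q → f (<⇒≤ q)))

climb-increasing : ∀ i w p j → p ≤ climb i w p j
climb-increasing zero    w p j = ≤-refl
climb-increasing (suc i) w p j = ≤-trans (climb-increasing i w p (suc j)) (grow-increasing j (w j) _)

climb-monoʳ-< : ∀ i {w p p′ j} → p < p′ → climb i w p j < climb i w p′ j
climb-monoʳ-< zero    q = q
climb-monoʳ-< (suc i) {j = j} q = grow-monoʳ-< j (climb-monoʳ-< i q)

descend-climb : ∀ i j w p → descend (i + j) w p ≡ descend j w (climb i w p j)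
descend-climb zero    j w p = refl
descend-climb (suc i) j w p = trans (cong (λ k → descend k w p) (sym (+-suc i j))) (descend-climb i (suc j) w p)

-- The tiers are the intermediate results of the descent, which can thus be interrupted at any level
-- and resumed there.
descend-tier : ∀ {K j} w p → j ≤ suc K → descend (suc K) w p ≡ descend j w (tier K w p j)
descend-tier {K} {j} w p q =
  trans (cong (λ k → descend k w p) (sym (m∸n+n≡m q))) (descend-climb (suc K ∸ j) j w p)

tier-step : ∀ {K j} w p → j ≤ K → tier K w p j ≡ grow j (w j) (tier K w p (suc j))
tier-step {K} {j} w p q = cong (λ i → climb i w p j) (+-∸-assoc 1 q)

tier-base : ∀ {K j} w {p} → 1 ≤ p → j ≤ K → w j ≤ tier K w p j
tier-base {K} {j} w {p} q r rewrite tier-step {K} {j} w p r =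
  grow-base j (w j) (≤-trans q (climb-increasing (K ∸ j) w p (suc j)))

-- The invariant relating u, the result of processing the levels from the
-- level of the head variable down to j in the world of the lower tiers t⁻,
-- to the tier t.
Absorbed : ℕ → ℕ → ℕ → ℕ → Set
Absorbed 0             u t⁻ t = u ≤ t
Absorbed 1             u t⁻ t = t⁻ + u ≤ t
Absorbed (suc (suc _)) u t⁻ t = 1 ≤ u × suc t⁻ * suc u ≤ t

-- For x a power of 2 + a, this absorbs the summand 2 of the next base into one more factor.
2+x≤[2+a]x : ∀ a {x} → 2 ≤ x → 2 + x ≤ (2 + a) * x
2+x≤[2+a]x a {x} p = begin
  2 + x             ≤⟨ +-monoˡ-≤ x p ⟩
  x + x             ≤⟨ +-monoʳ-≤ x (m≤m+n x (a * x)) ⟩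
  x + (x + a * x)   ∎
  where open ≤-Reasoning

2≤[2+a]^ : ∀ a {t} → 1 ≤ t → 2 ≤ (2 + a) ^ t
2≤[2+a]^ a p = ≤-trans (s≤s p) (n<[2+a]^n a _)

2+a≤[2+a]^ : ∀ a {t} → 1 ≤ t → 2 + a ≤ (2 + a) ^ t
2+a≤[2+a]^ a {suc t} p = m≤m*n (2 + a) ((2 + a) ^ t) {{>-nonZero (1≤[2+a]^t a t)}}

-- Going from `t⁻` to `t` adds at least 2 + a on level 1 and multiplies by at least 2 + a above it,
-- which makes room for the entry `a` of the head variable.
absorbed-start : ∀ k a {t⁻ t} → 1 ≤ a → 1 ≤ t⁻ → t⁻ < t → Absorbed k a (grow k a t⁻) (grow k a t)
absorbed-start 0 a {t⁻} {t} p q r = m≤m+n a t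
absorbed-start 1 a {t⁻} {t} p q r = begin
  (2 + a) * t⁻ + a         ≤⟨ +-monoʳ-≤ ((2 + a) * t⁻) (m≤n+m a 2) ⟩
  (2 + a) * t⁻ + (2 + a)   ≡⟨ +-comm ((2 + a) * t⁻) (2 + a) ⟩
  (2 + a) + (2 + a) * t⁻   ≡⟨ sym (*-suc (2 + a) t⁻) ⟩
  (2 + a) * suc t⁻         ≤⟨ *-monoʳ-≤ (2 + a) r ⟩
  (2 + a) * t              ∎
  where open ≤-Reasoning
absorbed-start (suc (suc _)) a {t⁻} {t} p q r = p , (begin
  suc x * suc a            ≡⟨ *-comm (suc x) (suc a) ⟩
  suc a * suc x            ≡⟨ *-suc (suc a) x ⟩
  suc a + suc a * x        ≤⟨ +-monoˡ-≤ (suc a * x) (≤-trans (n≤1+n _) (2+a≤[2+a]^ a q)) ⟩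
  (2 + a) ^ suc t⁻         ≤⟨ ^-monoʳ-≤ (2 + a) r ⟩
  (2 + a) ^ t              ∎)
  where open ≤-Reasoning
        x = (2 + a) ^ t⁻

-- From level 2 on, a base that is itself a power of 2 + a is raised to `u`: the exponents multiply,
-- and the product in the invariant one level up bounds them.
absorbed-step : ∀ j a {u t⁻ t} → 1 ≤ t⁻ → Absorbed (suc j) u t⁻ t →
                Absorbed j (grow j (grow j a t⁻) u) (grow j a t⁻) (grow j a t)
absorbed-step 0 a {u} {t⁻} {t} q r = begin
  a + t⁻ + u     ≡⟨ +-assoc a t⁻ u ⟩
  a + (t⁻ + u)   ≤⟨ +-monoʳ-≤ a r ⟩
  a + t          ∎
  where open ≤-Reasoning
absorbed-step 1 a {u} {t⁻} {t} q (_ , r) = begin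
  b * t⁻ + (2 + b * t⁻) * u       ≤⟨ +-mono-≤ (*-monoʳ-≤ b (n≤1+n t⁻)) (*-monoˡ-≤ u (+-monoˡ-≤ (b * t⁻) (m≤m+n 2 a))) ⟩
  b * suc t⁻ + (b + b * t⁻) * u   ≡⟨ cong (λ z → b * suc t⁻ + z * u) (sym (*-suc b t⁻)) ⟩
  b * suc t⁻ + b * suc t⁻ * u     ≡⟨ sym (*-suc (b * suc t⁻) u) ⟩
  b * suc t⁻ * suc u              ≡⟨ *-assoc b (suc t⁻) (suc u) ⟩
  b * (suc t⁻ * suc u)            ≤⟨ *-monoʳ-≤ b r ⟩
  b * t                           ∎
  where open ≤-Reasoning
        b = 2 + a
absorbed-step (suc (suc j)) a {u} {t⁻} {t} q (p , r) = 1≤[2+a]^t x u , (begin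
  suc x * suc y              ≡⟨ *-suc (suc x) y ⟩
  suc x + suc x * y          ≤⟨ +-monoˡ-≤ (suc x * y) (≤-trans (n≤1+n _) (2+a≤[2+a]^ x p)) ⟩
  (2 + x) ^ suc u            ≤⟨ ^-monoˡ-≤ (suc u) (2+x≤[2+a]x a (2≤[2+a]^ a q)) ⟩
  ((2 + a) ^ suc t⁻) ^ suc u ≡⟨ ^-*-assoc (2 + a) (suc t⁻) (suc u) ⟩
  (2 + a) ^ (suc t⁻ * suc u) ≤⟨ ^-monoʳ-≤ (2 + a) r ⟩
  (2 + a) ^ t                ∎)
  where open ≤-Reasoning
        x = (2 + a) ^ t⁻
        y = (2 + x) ^ u

descend-absorbed : ∀ {K} k {w p u} → k ≤ suc K → 1 ≤ p →
  Absorbed k u (tier K w p k) (tier K w (suc p) k) →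
  descend k (tier K w p) u ≤ tier K w (suc p) 0
descend-absorbed zero q r h = h
descend-absorbed {K} (suc k) {w} {p} {u} q r h =
  descend-absorbed k (<⇒≤ q) r
    (subst₂ (λ a b → Absorbed k (grow k a u) a b)
      (sym (tier-step w p (≤-pred q))) (sym (tier-step w (suc p) (≤-pred q)))
      (absorbed-step k (w k) (≤-trans r (climb-increasing (K ∸ k) w p (suc k))) h))

-- A head variable of level `k` runs in the world of the tiers of its arguments. A single further
-- unit of `p` pays for this.
descend-tiers : ∀ {K k w p} → k ≤ K → 1 ≤ p → 1 ≤ w k →
                descend k (tier K w p) (w k) ≤ descend (suc K) w (suc p)
descend-tiers {K} {k} {w} {p} q r s = begin
  descend k (tier K w p) (w k)  ≤⟨ descend-absorbed k (m≤n⇒m≤1+n q) r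
    (subst₂ (Absorbed k (w k)) (sym (tier-step w p q)) (sym (tier-step w (suc p) q))
      (absorbed-start k (w k) s (≤-trans r (climb-increasing (K ∸ k) w p (suc k)))
        (climb-monoʳ-< (K ∸ k) {w} {j = suc k} ≤-refl))) ⟩
  tier K w (suc p) 0            ≡⟨ sym (descend-tier {K} w (suc p) z≤n) ⟩
  descend (suc K) w (suc p)     ∎
  where open ≤-Reasoning

-- The upper bound

infix 4 _≤[_]_

_≤[_]_ : World → ℕ → World → Set
w ≤[ k ] w′ = ∀ {i} → i < k → w i ≤ w′ i

-- In Bounded w A p v, the number p accounts for the free variables of v of levels
-- at least lv A, and w for those of lower levels: quantifying over larger worlds
-- lets them share the entries of w with the variables bound in v.
mutual
  Bounded : World → ∀ A → ℕ → ⟦ A ⟧ → Set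
  Bounded w A p v = ∀ {w′} → w ≤[ lv A ] w′ → ∀ {s} → InWorld w′ A s → run A v s ≤ descend (lv A) w′ p

  InWorld : World → ∀ A → Stack A → Set
  InWorld w o       _       = ⊤
  InWorld w (A ⇒ B) (v , s) = Bounded w A (w (lv A)) v × InWorld w B s

Bounded-mono : ∀ {w w′} A {p p′ v} → w ≤[ lv A ] w′ → p ≤ p′ → Bounded w A p v → Bounded w′ A p′ v
Bounded-mono A q r b q′ i = ≤-trans (b (λ l → ≤-trans (q l) (q′ l)) i) (descend-mono (lv A) (λ _ → ≤-refl) r)

arg-lv< : ∀ A B → lv A < lv (A ⇒ B)
arg-lv< A B = m≤m⊔n (suc (lv A)) (lv B)

≤[]-arg : ∀ {w w′} A B → w ≤[ lv (A ⇒ B) ] w′ → w ≤[ lv A ] w′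
≤[]-arg A B q l = q (<-trans l (arg-lv< A B))

≤[]-res : ∀ {w w′} A B → w ≤[ lv (A ⇒ B) ] w′ → w ≤[ lv B ] w′
≤[]-res A B q l = q (≤-trans l (m≤n⊔m (suc (lv A)) (lv B)))

InWorld-mono : ∀ {w w′} A {s} → w ≤[ lv A ] w′ → InWorld w A s → InWorld w′ A s
InWorld-mono o       q _       = tt
InWorld-mono (A ⇒ B) q (b , i) =
  Bounded-mono A (≤[]-arg A B q) (q (arg-lv< A B)) b , InWorld-mono B (≤[]-res A B q) i

splice : ℕ → World → World → World
splice j w w′ i with i <? j
... | yes _ = w i
... | no _  = w′ i

splice-< : ∀ {i j} w w′ → i < j → splice j w w′ i ≡ w i
splice-< {i} {j} w w′ p with i <? j
... | yes _ = refl
... | no q  = ⊥-elim (q p)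

splice-≥ : ∀ {i j} w w′ → j ≤ i → splice j w w′ i ≡ w′ i
splice-≥ {i} {j} w w′ p with i <? j
... | yes q = ⊥-elim (<⇒≱ q p)
... | no _  = refl

splice-above : ∀ j {w w′} → w′ ≤[ j ] w → ∀ i → w′ i ≤ splice j w w′ i
splice-above j p i with i <? j
... | yes q = p q
... | no _  = ≤-refl

module _ (K h⋆ : ℕ) where

  world : ℕ → World
  -- No closed argument has been bounded yet; the value 1 rather than 0 meets the positivity
  -- hypothesis of `descend-tiers`.
  world zero    j = 1
  world (suc d) j = tier K (world d) (suc (2 * h⋆)) j

  world-suc : ∀ d {j} → j ≤ K → world d j ≤ world (suc d) j
  world-suc d q = tier-base (world d) (s≤s z≤n) q

  world-pos : ∀ d {j} → j ≤ K → 1 ≤ world d j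
  world-pos zero    q = ≤-refl
  world-pos (suc d) q = ≤-trans (world-pos d q) (world-suc d q)

  -- The second alternative is for the free variables of the whole term, whose
  -- level may exceed K; they denote null.
  EnvOK : World → ∀ A → ⟦ A ⟧ → Set
  EnvOK w A v = (lv A ≤ K × Bounded w A (w (lv A)) v) ⊎ (∀ s → run A v s ≡ 0)

  EnvOK-mono : ∀ {w w′ A v} → (∀ i → w i ≤ w′ i) → EnvOK w A v → EnvOK w′ A v
  EnvOK-mono {A = A} q (inj₁ (p , b)) = inj₁ (p , Bounded-mono A (λ {i} _ → q i) (q (lv A)) b)
  EnvOK-mono q (inj₂ z)       = inj₂ z

  -- An argument of depth δ and local height η, which c states to be closed, is
  -- either bound by an abstraction or left to a head variable.
  record Entry (w : World) (d : ℕ) (c : Set) (δ η : ℕ) (A : Type) (v : ⟦ A ⟧) : Set where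
    field
      atRedex : c → suc δ ≤ d → η ≤ h⋆ → Bounded w A (w (lv A)) v
      atHead  : ∀ {h} → δ ≤ d → η ≤ h → h ≤ h⋆ → Bounded w A (tier K w (suc (2 * h)) (lv A)) v
  open Entry

  -- First the arguments present in the term, with their measures; then unknown values, of which
  -- only the world is known.
  data Spine (w : World) (d : ℕ) : ∀ A → Stack A → List Set → List ℕ → List ℕ → Set₁ where
    generic : ∀ {A s} → InWorld w A s → Spine w d A s [] [] []
    _∷_     : ∀ {A B v s c cs δ δs η ηs} → Entry w d c δ η A v → Spine w d B s cs δs ηs →
              Spine w d (A ⇒ B) (v , s) (c ∷ cs) (δ ∷ δs) (η ∷ ηs)

  spine-inTiers : ∀ {w d h A s cs δs ηs} → lv A ≤ K → h ≤ h⋆ →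
    maximum 1 δs ≤ d → maximum 0 ηs ≤ h → Spine w d A s cs δs ηs →
    InWorld (tier K w (suc (2 * h))) A s
  spine-inTiers {w} {A = A} k l _ _ (generic i) =
    InWorld-mono A (λ q → tier-base w (s≤s z≤n) (≤-trans (<⇒≤ q) k)) i
  spine-inTiers {w} {A = A ⇒ B} k l p q (_∷_ {δ = δ} {η = η} e sp) =
    Bounded-mono A (λ q → tier-base w (s≤s z≤n) (≤-trans (<⇒≤ q) (<⇒≤ k′))) ≤-refl
      (atHead e (m⊔n≤o⇒m≤o δ _ p) (m⊔n≤o⇒m≤o η _ q) l) ,
    spine-inTiers (≤-trans (m≤n⊔m (suc (lv A)) (lv B)) k) l
      (m⊔n≤o⇒n≤o δ _ p) (m⊔n≤o⇒n≤o η _ q) sp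
    where k′ = ≤-trans (arg-lv< A B) k

  ▸-OK : ∀ {Γ A B C} {L : A ∷ Γ ⊢ B} {γ : Env Γ} {w v} →
         (∀ {C} (x : C ∈ Γ) → x FreeIn ƛ L → EnvOK w C (γ x)) → EnvOK w A v →
         (x : C ∈ A ∷ Γ) → x FreeIn L → EnvOK w C ((γ ▸ v) x)
  ▸-OK p q (here refl) f = q
  ▸-OK p q (there x)   f = p x (ƛ f)

  ord⇒lv : ∀ {Γ A n} (M : Γ ⊢ A) → ord M ≤ n → lv A ≤ n
  ord⇒lv (var x) p = p
  ord⇒lv {A = A} (ƛ M) p   = m⊔n≤o⇒m≤o (lv A) _ p
  ord⇒lv {A = A} (M · N) p = m⊔n≤o⇒m≤o (lv A) _ p
  ord⇒lv ∗ p       = p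

  mutual
    -- Both bounds of an argument are prepared when its application is traversed, and used later at
    -- a redex or at the head. This keeps the induction structural.
    run-bounded : ∀ {Γ A} (L : Γ ⊢ A) {γ : Env Γ} {w d h s cs δs ηs} →
      (∀ {B} (x : B ∈ Γ) → x FreeIn L → EnvOK w B (γ x)) → (∀ {j} → j ≤ K → world d j ≤ w j) →
      h ≤ h⋆ → ord L ≤ suc K → Scoped L cs → depthApp L δs ≤ d → lhApp L ηs ≤ h →
      Spine w d A s cs δs ηs → run A (eval L γ) s ≤ descend (suc K) w (2 * h)
    run-bounded {A = A} (var x) {d = d} {s = s} envOK above h≤ ord≤ sc d≤ (s≤s {n = h} lh≤) sp
      with envOK x var
    ... | inj₂ z rewrite z s = z≤n
    -- The arguments have local height at most `h`, one less than the whole. Of the two units of `p`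
    -- per unit of height, one pays for the ticks of the arguments and the other for
    -- `descend-tiers`.
    ... | inj₁ (k , b) = begin
      run A _ s                                              ≤⟨ b {tier K _ (suc (2 * h))}
        (λ q → tier-base _ (s≤s z≤n) (≤-trans (<⇒≤ q) k))
        (spine-inTiers k (<⇒≤ h≤) d≤ lh≤ sp) ⟩
      descend (lv A) (tier K _ (suc (2 * h))) _              ≤⟨ descend-tiers k (s≤s z≤n) (≤-trans (world-pos d k) (above k)) ⟩
      descend (suc K) _ (2 + 2 * h)                          ≡⟨ cong (descend (suc K) _) (sym (*-suc 2 h)) ⟩
      descend (suc K) _ (2 * suc h)                          ∎
      where open ≤-Reasoning
    run-bounded {A = A} ∗ {s = s} envOK above h≤ ord≤ sc d≤ lh≤ sp rewrite run-null A s = z≤n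
    run-bounded {A = A ⇒ B} (ƛ L) {s = _ , _} envOK above h≤ ord≤ sc d≤ lh≤ (generic (b , i)) =
      run-bounded L (▸-OK envOK (inj₁ (lv≤ , b))) above h≤ (m⊔n≤o⇒n≤o (lv (A ⇒ B)) _ ord≤) sc d≤ lh≤ (generic i)
      where lv≤ = ≤-pred (≤-trans (arg-lv< A B) (ord⇒lv (ƛ L) ord≤))
    run-bounded {A = A ⇒ B} (ƛ L) envOK above h≤ ord≤ (c , sc) d≤ lh≤ (_∷_ {δs = δs} {ηs = ηs} e sp) =
      run-bounded L (▸-OK envOK (inj₁ (lv≤ , atRedex e c (m⊔n≤o⇒n≤o (depthApp L δs) _ d≤)
                      (≤-trans (m⊔n≤o⇒n≤o (lhApp L ηs) _ lh≤) h≤))))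
        above h≤ (m⊔n≤o⇒n≤o (lv (A ⇒ B)) _ ord≤) sc
        (m⊔n≤o⇒m≤o (depthApp L δs) _ d≤) (m⊔n≤o⇒m≤o (lhApp L ηs) _ lh≤) sp
      where lv≤ = ≤-pred (≤-trans (arg-lv< A B) (ord⇒lv (ƛ L) ord≤))
    run-bounded (_·_ {A} {B} L M) {γ} {w} {d} envOK above h≤ ord≤ (scM , scL) d≤ lh≤ sp =
      run-bounded L (λ x f → envOK x (appˡ f)) above h≤ ordL scL d≤ lh≤ (entry ∷ sp)
      where
        ordLM = m⊔n≤o⇒n≤o (lv B) _ ord≤
        ordL  = m⊔n≤o⇒m≤o (ord L) _ ordLM
        ordM  = m⊔n≤o⇒n≤o (ord L) _ ordLM
        lv≤   = ≤-pred (≤-trans (arg-lv< A B) (ord⇒lv L ordL))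
        -- For a closed argument the condition on the environment is void, so `w` can be exchanged
        -- for the world of the next smaller depth. With the full height `h⋆` its tier is then an
        -- entry of `world d`.
        whenClosed : ∀ {d} → (∀ {j} → j ≤ K → world d j ≤ w j) →
                     Closed M → suc (depth M) ≤ d → lh M ≤ h⋆ → Bounded w A (w (lv A)) (tick A (eval M γ))
        whenClosed {suc d} above c δ≤ η≤ =
          Bounded-mono A (λ q → ≤-trans (world-suc d (≤-trans (<⇒≤ q) lv≤)) (above (≤-trans (<⇒≤ q) lv≤))) (above lv≤)
            (arg-bounded M lv≤ (λ x f → ⊥-elim (c x f)) (λ _ → ≤-refl) ≤-refl ordM scM (≤-pred δ≤) η≤)
        entry : Entry w d (Closed M) (depth M) (lh M) A (tick A (eval M γ))
        entry = record
          { atRedex = whenClosed above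
          ; atHead  = λ δ≤ η≤ h≤ → arg-bounded M lv≤ (λ x f → envOK x (appʳ f)) above h≤ ordM scM δ≤ η≤ }

    -- The free variables are bounded in `w` and the stack in `w′`; the spliced world serves both.
    -- Strict monotonicity in `p` pays for the tick.
    arg-bounded : ∀ {Γ A} (M : Γ ⊢ A) {γ : Env Γ} {w d h} → lv A ≤ K →
      (∀ {B} (x : B ∈ Γ) → x FreeIn M → EnvOK w B (γ x)) → (∀ {j} → j ≤ K → world d j ≤ w j) →
      h ≤ h⋆ → ord M ≤ suc K → Scoped M [] → depth M ≤ d → lh M ≤ h →
      Bounded w A (tier K w (suc (2 * h)) (lv A)) (tick A (eval M γ))
    arg-bounded {A = A} M {γ} {w} {h = h} lv≤ envOK above h≤ ord≤ sc d≤ lh≤ {w′} q {s} i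
      rewrite run-tick A (eval M γ) s = begin-strict
      run A (eval M γ) s                    ≤⟨ run-bounded M (λ x f → EnvOK-mono w≤ (envOK x f))
                                                 (λ {j} p → ≤-trans (above p) (w≤ j)) h≤ ord≤ sc d≤ lh≤ (generic i″) ⟩
      descend (suc K) w″ (2 * h)            <⟨ descend-monoʳ-< (suc K) ≤-refl ⟩
      descend (suc K) w″ (suc (2 * h))      ≡⟨ descend-tier w″ _ (m≤n⇒m≤1+n lv≤) ⟩
      descend (lv A) w″ (tier K w″ _ (lv A)) ≤⟨ descend-mono (lv A) (λ p → ≤-reflexive (splice-< w′ w p))
                                                 (climb-mono (suc K ∸ lv A) (λ p → ≤-reflexive (splice-≥ w′ w p))) ⟩
      descend (lv A) w′ (tier K w _ (lv A)) ∎
      where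
        open ≤-Reasoning
        w″ = splice (lv A) w′ w
        w≤ = splice-above (lv A) q
        i″ : InWorld w″ A s
        i″ = InWorld-mono A (λ p → ≤-reflexive (sym (splice-< w′ w p))) i

  cost-bounded : ∀ {Γ A} (M : Γ ⊢ A) {d} → Admissible (suc K) h⋆ d M →
                 cost M ≤ world (suc d) 0
  cost-bounded {A = A} M {d} a = begin
    cost M                                  ≤⟨ run-bounded M (λ {B} _ _ → inj₂ (run-null B)) (λ _ → ≤-refl) ≤-refl
      ord≤ (StronglyLocallyScoped⇒Scoped M scoped) depth≤ lh≤ (generic (nulls-in A)) ⟩
    descend (suc K) (world d) (2 * h⋆)      ≤⟨ <⇒≤ (descend-monoʳ-< (suc K) ≤-refl) ⟩
    descend (suc K) (world d) (suc (2 * h⋆)) ≡⟨ descend-tier {K} (world d) _ z≤n ⟩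
    world (suc d) 0                         ∎
    where
      open ≤-Reasoning
      open Admissible a
      nulls-in : ∀ A → InWorld (world d) A (nulls A)
      nulls-in o       = tt
      nulls-in (A ⇒ B) = (λ _ {s} _ → subst (_≤ _) (sym (run-null A s)) z≤n) , nulls-in B

-- Towers of exponentials above the worlds

tow : ℕ → ℕ → ℕ
tow zero    x = x
tow (suc k) x = 2 ^ tow k x

2^-mono : ∀ {m n} → m ≤ n → 2 ^ m ≤ 2 ^ n
2^-mono = ^-monoʳ-≤ 2

1≤2^ : ∀ n → 1 ≤ 2 ^ n
1≤2^ n = m^n>0 2 n

n<2^n : ∀ n → n < 2 ^ n
n<2^n = n<[2+a]^n 0

2^+2^ : ∀ n → 2 ^ n + 2 ^ n ≡ 2 ^ suc n
2^+2^ n = cong (2 ^ n +_) (sym (+-identityʳ (2 ^ n)))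

3·2^+2 : ∀ {x} → 1 ≤ x → 3 * 2 ^ x + 2 ≤ 2 ^ (2 + x)
3·2^+2 {x} p = begin
  3 * 2 ^ x + 2        ≤⟨ +-monoʳ-≤ (3 * 2 ^ x) (2^-mono p) ⟩
  3 * 2 ^ x + 2 ^ x    ≡⟨ solve 1 (λ y → con 3 :* y :+ y := con 2 :* (con 2 :* y)) refl (2 ^ x) ⟩
  2 ^ (2 + x)          ∎
  where open ≤-Reasoning

grow₁-≤-2^ : ∀ {a t e f} → 2 + a ≤ 2 ^ e → suc t ≤ 2 ^ f → 2 + grow 1 a t ≤ 2 ^ (e + f)
grow₁-≤-2^ {a} {t} {e} {f} p q = begin
  2 + (2 + a) * t        ≤⟨ +-monoˡ-≤ ((2 + a) * t) (m≤m+n 2 a) ⟩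
  (2 + a) + (2 + a) * t  ≡⟨ sym (*-suc (2 + a) t) ⟩
  (2 + a) * suc t        ≤⟨ *-mono-≤ p q ⟩
  2 ^ e * 2 ^ f          ≡⟨ sym (^-distribˡ-+-* 2 e f) ⟩
  2 ^ (e + f)            ∎
  where open ≤-Reasoning

grow₂-≤-2^ : ∀ k {a t e f} → 1 ≤ t → 2 + a ≤ 2 ^ e → suc t ≤ 2 ^ f → 2 + grow (2 + k) a t ≤ 2 ^ (e * 2 ^ f)
grow₂-≤-2^ k {a} {t} {e} {f} r p q = begin
  2 + (2 + a) ^ t        ≤⟨ 2+x≤[2+a]x a (2≤[2+a]^ a r) ⟩
  (2 + a) ^ suc t        ≤⟨ ^-monoˡ-≤ (suc t) p ⟩
  (2 ^ e) ^ suc t        ≡⟨ ^-*-assoc 2 e (suc t) ⟩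
  2 ^ (e * suc t)        ≤⟨ 2^-mono (*-monoʳ-≤ e q) ⟩
  2 ^ (e * 2 ^ f)        ∎
  where open ≤-Reasoning

3≤2^ : ∀ {e} → 2 ≤ e → 3 ≤ 2 ^ e
3≤2^ p = ≤-trans (n≤1+n 3) (2^-mono p)

world-step : ∀ K h d {j} → j ≤ K → world K h (suc d) j ≡ grow j (world K h d j) (world K h (suc d) (suc j))
world-step K h d p = tier-step (world K h d) _ p

world-top : ∀ K h d → world K h (suc d) (suc K) ≡ suc (2 * h)
world-top K h d rewrite n∸n≡0 K = refl

module _ (g : ℕ) (2≤g : 2 ≤ g) where

  -- The factor 3 leaves room for the entry of depth d next to the tier of depth
  -- d + 1: with x = expo i d and y = expo i (suc d) ≥ 2x, 2^(3x) · 2^y ≤ 2^(3y).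
  expo : ℕ → ℕ → ℕ
  expo zero    d = 2 ^ (g * suc d)
  expo (suc i) d = 2 ^ (3 * expo i d)

  2≤expo : ∀ i d → 2 ≤ expo i d
  2≤expo zero    d = 2^-mono {1} (≤-trans (<⇒≤ 2≤g) (m≤m*n g (suc d)))
  2≤expo (suc i) d = 2^-mono {1} (≤-trans (≤-trans (s≤s z≤n) (2≤expo i d)) (m≤n*m (expo i d) 3))

  expo-double : ∀ i d → 2 * expo i d ≤ expo i (suc d)
  expo-double zero d = begin
    2 * 2 ^ (g * suc d)   ≡⟨⟩
    2 ^ suc (g * suc d)   ≤⟨ 2^-mono (+-monoˡ-≤ (g * suc d) (<⇒≤ 2≤g)) ⟩
    2 ^ (g + g * suc d)   ≡⟨ cong (2 ^_) (sym (*-suc g (suc d))) ⟩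
    2 ^ (g * suc (suc d)) ∎
    where open ≤-Reasoning
  expo-double (suc i) d = 2^-mono (begin
    suc (3 * expo i d)      ≤⟨ +-monoˡ-≤ (3 * expo i d) (≤-trans (s≤s z≤n) (2≤expo i d)) ⟩
    expo i d + 3 * expo i d ≤⟨ m≤m+n _ (expo i d + expo i d) ⟩
    expo i d + 3 * expo i d + (expo i d + expo i d)
                            ≡⟨ solve 1 (λ x → x :+ con 3 :* x :+ (x :+ x) := con 3 :* (con 2 :* x)) refl (expo i d) ⟩
    3 * (2 * expo i d)      ≤⟨ *-monoʳ-≤ 3 (expo-double i d) ⟩
    3 * expo i (suc d)      ∎)
    where open ≤-Reasoning

  d<expo : ∀ i d → d < expo i d
  d<expo zero d = <-trans (n<2^n d) (^-monoʳ-< 2 ≤-refl (m≤n*m (suc d) g {{>-nonZero (<⇒≤ 2≤g)}}))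
  d<expo (suc i) d = <-trans (<-≤-trans (d<expo i d) (m≤n*m (expo i d) 3)) (n<2^n (3 * expo i d))

  expo-tow : ∀ i d {x} → 2 + g * suc d ≤ x → 3 * expo i d + 2 ≤ tow (suc i) x
  expo-tow zero d p = ≤-trans (3·2^+2 (≤-trans (<⇒≤ 2≤g) (m≤m*n g (suc d)))) (2^-mono p)
  expo-tow (suc i) d p = ≤-trans (3·2^+2 (≤-trans (≤-trans (s≤s z≤n) (2≤expo i d)) (m≤n*m (expo i d) 3)))
    (2^-mono (≤-trans (≤-reflexive (+-comm 2 (3 * expo i d))) (expo-tow i d p)))

  -- On level 1 tiers arise by products, so exponents add up over the depths where on higher levels
  -- they multiply.
  expo₁ : ℕ → ℕ → ℕ
  expo₁ zero    d = g * suc d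
  expo₁ (suc i) d = 2 * expo i d

  expo₁-suc : ∀ i d → expo₁ i d ≤ expo₁ i (suc d)
  expo₁-suc zero    d = *-monoʳ-≤ g (n≤1+n _)
  expo₁-suc (suc i) d = *-monoʳ-≤ 2 (≤-trans (m≤n*m (expo i d) 2) (expo-double i d))

  module _ (h : ℕ) (h≤ : suc (suc (2 * h)) ≤ 2 ^ g) where

    -- Here `i` is the distance from the top level. For `i = 0` each depth multiplies the exponent
    -- by at most 2^g, with `g` about log h; each level below adds one exponential.
    world-high : ∀ i k d → 2 + world (i + (2 + k)) h d (2 + k) ≤ 2 ^ expo i d
    world-high i k zero = 3≤2^ (2≤expo i 0)
    world-high zero k (suc d) =
      ≤-trans (≤-reflexive (cong (2 +_) (trans (world-step (2 + k) h d {2 + k} ≤-refl)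
        (cong (grow (2 + k) (world (2 + k) h d (2 + k))) (world-top (2 + k) h d)))))
      (≤-trans (grow₂-≤-2^ k {e = 2 ^ (g * suc d)} {f = g} (s≤s z≤n) (world-high zero k d) h≤)
        (≤-reflexive (cong (2 ^_) (trans (sym (^-distribˡ-+-* 2 (g * suc d) g))
          (cong (2 ^_) (trans (+-comm (g * suc d) g) (sym (*-suc g (suc d)))))))))
    world-high (suc i) k (suc d) =
      ≤-trans (≤-reflexive (cong (2 +_) (world-step K h d {2 + k} (m≤n+m (2 + k) (suc i)))))
      (≤-trans (grow₂-≤-2^ k {e = expo (suc i) d} {f = expo i (suc d)}
                 (world-pos K h (suc d) (s≤s (m≤n+m (2 + k) i)))
                 (world-high (suc i) k d) (≤-trans (n≤1+n _) above))
        (2^-mono (begin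
          2 ^ (3 * expo i d) * 2 ^ expo i (suc d) ≡⟨ sym (^-distribˡ-+-* 2 (3 * expo i d) (expo i (suc d))) ⟩
          2 ^ (3 * expo i d + expo i (suc d))     ≤⟨ 2^-mono (+-monoˡ-≤ (expo i (suc d)) (m≤m+n (3 * expo i d) (expo i d))) ⟩
          2 ^ (3 * expo i d + expo i d + expo i (suc d))
            ≡⟨ cong (2 ^_) (solve 2 (λ x y → con 3 :* x :+ x :+ y := con 2 :* (con 2 :* x) :+ y) refl (expo i d) (expo i (suc d))) ⟩
          2 ^ (2 * (2 * expo i d) + expo i (suc d))
            ≤⟨ 2^-mono (+-monoˡ-≤ (expo i (suc d)) (*-monoʳ-≤ 2 (expo-double i d))) ⟩
          2 ^ (2 * expo i (suc d) + expo i (suc d))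
            ≡⟨ cong (2 ^_) (solve 1 (λ y → con 2 :* y :+ y := con 3 :* y) refl (expo i (suc d))) ⟩
          2 ^ (3 * expo i (suc d))  ∎)))
      where
        open ≤-Reasoning
        K = suc i + (2 + k)
        above : 2 + world K h (suc d) (3 + k) ≤ 2 ^ expo i (suc d)
        above = subst (λ K → 2 + world K h (suc d) (3 + k) ≤ 2 ^ expo i (suc d)) (+-suc i (2 + k)) (world-high i (suc k) (suc d))

    world-1 : ∀ i d → 2 + world (suc i) h d 1 ≤ 2 ^ expo₁ i d
    world-1 zero    zero = 3≤2^ (≤-trans 2≤g (m≤m*n g 1))
    world-1 (suc i) zero = 3≤2^ (m≤m*n 2 (expo i 0) {{>-nonZero (<⇒≤ (2≤expo i 0))}})
    world-1 zero (suc d) =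
      ≤-trans (grow₁-≤-2^ {e = g * suc d} {f = g} (world-1 zero d) h≤)
        (≤-reflexive (cong (2 ^_) (trans (+-comm (g * suc d) g) (sym (*-suc g (suc d))))))
    world-1 (suc i) (suc d) =
      ≤-trans (grow₁-≤-2^ {e = 2 * expo i d} {f = expo i (suc d)} (world-1 (suc i) d) (≤-trans (n≤1+n _) above))
        (2^-mono (≤-trans (+-monoˡ-≤ (expo i (suc d)) (expo-double i d))
          (≤-reflexive (cong (expo i (suc d) +_) (sym (+-identityʳ _))))))
      where
        above : 2 + world (2 + i) h (suc d) 2 ≤ 2 ^ expo i (suc d)
        above = subst (λ K → 2 + world K h (suc d) 2 ≤ 2 ^ expo i (suc d)) (+-comm i 2) (world-high i 0 (suc d))

    -- Level 0 adds the tiers of level 1 over all depths; each summand at most doubles the bound,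
    -- whence the term `d` in the exponent.
    world-0 : ∀ i d → 2 + world (suc i) h d 0 ≤ 2 ^ (expo₁ i d + (2 + d))
    world-0 i zero = 3≤2^ (m≤n+m 2 (expo₁ i 0))
    world-0 i (suc d) = begin
      2 + (world (suc i) h d 0 + world (suc i) h (suc d) 1)   ≡⟨⟩
      2 + world (suc i) h d 0 + world (suc i) h (suc d) 1     ≤⟨ +-mono-≤ (world-0 i d) (≤-trans (m≤n+m _ 2) (world-1 i (suc d))) ⟩
      2 ^ (expo₁ i d + (2 + d)) + 2 ^ expo₁ i (suc d)         ≤⟨ +-mono-≤ (2^-mono (+-monoˡ-≤ (2 + d) (expo₁-suc i d))) (2^-mono (m≤m+n (expo₁ i (suc d)) (2 + d))) ⟩
      2 ^ x + 2 ^ x                                           ≡⟨ 2^+2^ x ⟩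
      2 ^ suc x                                               ≡⟨ cong (2 ^_) (sym (+-suc (expo₁ i (suc d)) (2 + d))) ⟩
      2 ^ (expo₁ i (suc d) + (3 + d))                         ∎
      where open ≤-Reasoning
            x = expo₁ i (suc d) + (2 + d)

    world-tow : ∀ i d {x} → g * (2 + d) + (3 + d) ≤ x → world (suc i) h (suc d) 0 ≤ tow (suc i) x
    world-tow zero d p = ≤-trans (≤-trans (m≤n+m _ 2) (world-0 zero (suc d))) (2^-mono p)
    world-tow (suc i) d {x} p = ≤-trans (≤-trans (m≤n+m _ 2) (world-0 (suc i) (suc d))) (2^-mono (begin
      2 * e + (3 + d)   ≡⟨ cong (2 * e +_) (+-comm 2 (suc d)) ⟩
      2 * e + (suc d + 2) ≤⟨ +-monoʳ-≤ (2 * e) (+-monoˡ-≤ 2 (<⇒≤ (d<expo i (suc d)))) ⟩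
      2 * e + (e + 2)   ≡⟨ solve 1 (λ e → con 2 :* e :+ (e :+ con 2) := con 3 :* e :+ con 2) refl e ⟩
      3 * e + 2         ≤⟨ expo-tow i (suc d) (≤-trans (≤-trans (≤-reflexive (+-comm 2 _)) (+-monoʳ-≤ (g * (2 + d)) (s≤s (s≤s z≤n)))) p) ⟩
      tow (suc i) x     ∎))
      where open ≤-Reasoning
            e = expo i (suc d)

cost-≤-tow : ∀ {n h d l Γ A} (M : Γ ⊢ A) → 1 ≤ l → 1 ≤ d → h < 2 ^ suc l →
             Admissible (2 + n) h d M → cost M ≤ tow (suc n) (13 * d * l)
cost-≤-tow {n} {h} {suc d} {suc l} M p q r a =
  ≤-trans (cost-bounded (suc n) h M a) (world-tow (3 + l) (s≤s (s≤s z≤n)) h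
    -- The constant 13 comes from the smallest case, where `l` and `d` below are 0 and both sides
    -- equal 13.
    (≤-trans (≤-reflexive (cong suc (sym (+-suc h (h + 0))))) (*-monoʳ-≤ 2 r)) n (suc d) (begin
      (3 + l) * (3 + d) + (4 + d) ≤⟨ m≤m+n _ _ ⟩
      (3 + l) * (3 + d) + (4 + d) + (12 * d * l + 10 * l + 9 * d) ≡⟨ solve 2 (λ l d →
         (con 3 :+ l) :* (con 3 :+ d) :+ (con 4 :+ d) :+ (con 12 :* d :* l :+ con 10 :* l :+ con 9 :* d) :=
         con 13 :* (con 1 :+ d) :* (con 1 :+ l)) refl l d ⟩
      13 * suc d * suc l ∎))
  where open ≤-Reasoning

-- The lower bound

num : ℕ → Type
num zero    = o
num (suc k) = num k ⇒ num k

lv-num : ∀ k → lv (num k) ≡ k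
lv-num zero    = refl
lv-num (suc k) rewrite lv-num k = m≥n⇒m⊔n≡m (n≤1+n k)

iterate : ∀ {Γ A} → ℕ → A ∷ (A ⇒ A) ∷ Γ ⊢ A
iterate zero    = var (here refl)
iterate (suc h) = var (there (here refl)) · iterate h

church : ∀ {Γ} A → ℕ → Γ ⊢ (A ⇒ A) ⇒ A ⇒ A
church A h = ƛ (ƛ (iterate h))

base : ∀ {Γ} k → Γ ⊢ num (suc k)
base zero    = ƛ (var (here refl))
base (suc k) = church (num k) 2

power : ∀ {Γ} k → ℕ → ℕ → Γ ⊢ num (suc k)
power k h zero    = base k
power k h (suc d) = church (num k) h · power k h d

saturate : ∀ {Γ} k → Γ ⊢ num (suc k) → Γ ⊢ o
saturate zero    M = M · ∗
saturate (suc k) M = saturate k (M · base k)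

-- The numeral a applied to the numeral b is b^a. Applied to a function of cost b it gives cost a ·
-- b, and a function of cost a adds a to its argument.
op : ℕ → ℕ → ℕ → ℕ
op 0             a b = a + b
op 1             a b = a * b
op (suc (suc _)) a b = b ^ a

op-zero : ∀ k a b → op k (op (suc k) 0 a) b ≡ b
op-zero 0             a b = refl
op-zero 1             a b = +-identityʳ b
op-zero (suc (suc k)) a b = *-identityʳ b

-- `op (suc k) h a` measures the h-fold iterate of a function of measure `a`; one more iteration is
-- associativity or a law of powers.
op-suc : ∀ k h a b → op k (op (suc k) (suc h) a) b ≡ op k a (op k (op (suc k) h a) b)
op-suc 0             h a b = +-assoc a (h * a) b
op-suc 1             h a b = *-assoc a (a ^ h) b
op-suc (suc (suc k)) h a b = trans (cong (b ^_) (*-comm a (a ^ h))) (sym (^-*-assoc b (a ^ h) a))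

-- v acts at least as the numeral a; on level 1, v adds at least a to the cost.
AtLeast : ∀ k → ℕ → ⟦ num k ⟧ → Set
AtLeast zero    a v = a ≤ v
AtLeast (suc k) a f = ∀ {b v} → AtLeast k b v → AtLeast k (op k a b) (f v)

AtLeast-tick : ∀ k {a v} → AtLeast k a v → AtLeast k a (tick (num k) v)
AtLeast-tick zero    p   = m≤n⇒m≤1+n p
AtLeast-tick (suc k) p q = AtLeast-tick k (p q)

iterate-atLeast : ∀ {Γ} k h (γ : Env Γ) {f v a b} → AtLeast (suc k) a f → AtLeast k b v →
                  AtLeast k (op k (op (suc k) h a) b) (eval (iterate h) (γ ▸ f ▸ v))
iterate-atLeast k zero    γ {v = v} {a} {b} p q = subst (λ c → AtLeast k c v) (sym (op-zero k a b)) q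
iterate-atLeast k (suc h) γ {f} {v} {a} {b} p q =
  subst (λ c → AtLeast k c (eval (iterate (suc h)) (γ ▸ f ▸ v))) (sym (op-suc k h a b))
    (p (AtLeast-tick k (iterate-atLeast k h γ p q)))

church-atLeast : ∀ {Γ} k h (γ : Env Γ) → AtLeast (2 + k) h (eval (church (num k) h) γ)
church-atLeast k h γ p q = iterate-atLeast k h γ p q

-- The value 1 of the identity is the tick it receives when passed as an argument.
baseValue : ℕ → ℕ
baseValue zero    = 1
baseValue (suc k) = 2

base-atLeast : ∀ {Γ} k (γ : Env Γ) → AtLeast (suc k) (baseValue k) (tick (num (suc k)) (eval (base k) γ))
base-atLeast zero    γ p   = s≤s p
base-atLeast (suc k) γ p q = AtLeast-tick k (church-atLeast k 2 γ p q)

powerValue : ℕ → ℕ → ℕ → ℕ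
powerValue zero    h d = h ^ d
powerValue (suc k) h d = 2 ^ h ^ d

powerValue-suc : ∀ k h d → powerValue k h (suc d) ≡ op (suc k) h (powerValue k h d)
powerValue-suc zero    h d = refl
powerValue-suc (suc k) h d = trans (cong (2 ^_) (*-comm h (h ^ d))) (sym (^-*-assoc 2 (h ^ d) h))

power-suc-atLeast : ∀ {Γ} k h d (γ : Env Γ) →
  AtLeast (suc k) (powerValue k h d) (tick (num (suc k)) (eval (power k h d) γ)) →
  AtLeast (suc k) (powerValue k h (suc d)) (eval (power k h (suc d)) γ)
power-suc-atLeast k h d γ p =
  subst (λ a → AtLeast (suc k) a (eval (power k h (suc d)) γ)) (sym (powerValue-suc k h d))
    (church-atLeast k h γ p)

power-atLeast : ∀ {Γ} k h d (γ : Env Γ) →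
                AtLeast (suc k) (powerValue k h d) (tick (num (suc k)) (eval (power k h d) γ))
power-atLeast zero    h zero    γ = base-atLeast 0 γ
power-atLeast (suc k) h zero    γ = base-atLeast (suc k) γ
power-atLeast k       h (suc d) γ = AtLeast-tick (suc k) {v = eval (power k h (suc d)) γ}
  (power-suc-atLeast k h d γ (power-atLeast k h d γ))

tow-suc : ∀ k a → tow (suc k) a ≡ tow k (2 ^ a)
tow-suc zero    a = refl
tow-suc (suc k) a = cong (2 ^_) (tow-suc k a)

-- Each numeral 2 turns a into 2^a; the identity on level 1 and the final constant add no
-- exponential.
saturate-atLeast : ∀ {Γ} k (M : Γ ⊢ num (suc k)) {a} (γ : Env Γ) → AtLeast (suc k) a (eval M γ) →
                   tow (k ∸ 1) a ≤ eval (saturate k M) γ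
saturate-atLeast zero M {a} γ p = ≤-trans (m≤m+n a 0) (p z≤n)
saturate-atLeast (suc zero) M {a} γ p =
  ≤-trans (≤-reflexive (sym (*-identityʳ a))) (saturate-atLeast zero (M · base 0) γ (p (base-atLeast 0 γ)))
saturate-atLeast (suc (suc k)) M {a} γ p =
  ≤-trans (≤-reflexive (tow-suc k a)) (saturate-atLeast (suc k) (M · base (suc k)) γ (p (base-atLeast (suc k) γ)))

tow-mono : ∀ k {a b} → a ≤ b → tow k a ≤ tow k b
tow-mono zero    p = p
tow-mono (suc k) p = ^-monoʳ-≤ 2 (tow-mono k p)

-- The numeral is applied at least once, since only as an argument does the base carry its tick.
program : ℕ → ℕ → ℕ → [] ⊢ o
program k h d = saturate k (power k h (suc d))

program-cost : ∀ k h d {x} → 2 ^ x ≤ h ^ suc d → tow (suc k) x ≤ cost (program k h d)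
program-cost k h d {x} p = begin
  tow (suc k) x                       ≡⟨ tow-suc k x ⟩
  tow k (2 ^ x)                       ≤⟨ tow-mono k p ⟩
  tow k (h ^ suc d)                   ≡⟨ powerValue-tow k ⟩
  tow (k ∸ 1) (powerValue k h (suc d))  ≤⟨ saturate-atLeast k (power k h (suc d)) nullEnv
                                               (power-suc-atLeast k h d nullEnv (power-atLeast k h d nullEnv)) ⟩
  cost (program k h d)                ∎
  where
    open ≤-Reasoning
    powerValue-tow : ∀ k → tow k (h ^ suc d) ≡ tow (k ∸ 1) (powerValue k h (suc d))
    powerValue-tow zero    = refl
    powerValue-tow (suc k) = tow-suc k _

-- Order, local height, depth and scope of the programs

ord-iterate : ∀ {Γ} k h → ord (iterate {Γ} {num k} h) ≤ suc k
ord-iterate k zero    = ≤-trans (≤-reflexive (lv-num k)) (n≤1+n k)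
ord-iterate k (suc h) = ⊔-lub (≤-trans (≤-reflexive (lv-num k)) (n≤1+n k))
                              (⊔-lub (≤-reflexive (lv-num (suc k))) (ord-iterate k h))

ord-church : ∀ {Γ} k h → ord (church {Γ} (num k) h) ≤ 2 + k
ord-church k h = ⊔-lub (≤-reflexive (lv-num (2 + k)))
  (⊔-lub (≤-trans (≤-reflexive (lv-num (suc k))) (n≤1+n _)) (≤-trans (ord-iterate k h) (n≤1+n _)))

ord-base : ∀ {Γ} k → ord (base {Γ} k) ≤ suc k
ord-base zero    = ≤-refl
ord-base {Γ} (suc k) = ord-church {Γ} k 2

ord-power : ∀ {Γ} k h d → ord (power {Γ} k h d) ≤ 2 + k
ord-power k h zero    = ≤-trans (ord-base k) (n≤1+n _)
ord-power k h (suc d) = ⊔-lub (≤-trans (≤-reflexive (lv-num (suc k))) (n≤1+n _))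
                              (⊔-lub (ord-church k h) (ord-power k h d))

ord-saturate : ∀ {Γ} k (M : Γ ⊢ num (suc k)) {n} → suc k ≤ n → ord M ≤ n → ord (saturate k M) ≤ n
ord-saturate zero    M p q = ⊔-lub z≤n (⊔-lub q z≤n)
ord-saturate (suc k) M p q = ord-saturate k (M · base k) (<⇒≤ p)
  (⊔-lub (≤-trans (≤-reflexive (lv-num (suc k))) (<⇒≤ p)) (⊔-lub q (≤-trans (ord-base k) (<⇒≤ p))))

lh-iterate : ∀ {Γ A} h {b} hs → h ≤ b → maximum 0 hs ≤ b → lhApp (iterate {Γ} {A} h) hs ≤ suc b
lh-iterate zero    hs p q = s≤s q
lh-iterate (suc h) hs p q = s≤s (⊔-lub (≤-trans (lh-iterate h [] ≤-refl z≤n) p) q)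

lh-church : ∀ {Γ A} h {b η} hs → h ≤ b → η ≤ suc b → maximum 0 hs ≤ b →
            lhApp (church {Γ} A h) (η ∷ hs) ≤ suc b
lh-church h []       p q r = ⊔-lub (lh-iterate h [] p r) q
lh-church h (η ∷ hs) p q r =
  ⊔-lub (⊔-lub (lh-iterate h hs p (m⊔n≤o⇒n≤o η _ r)) (m≤n⇒m≤1+n (m⊔n≤o⇒m≤o η _ r))) q

lh-base : ∀ {Γ} k {b} hs → 2 ≤ b → maximum 0 hs ≤ b → lhApp (base {Γ} k) hs ≤ suc b
lh-base zero    []       p q = s≤s z≤n
lh-base zero    (η ∷ hs) p q = ⊔-lub (s≤s (m⊔n≤o⇒n≤o η _ q)) (m≤n⇒m≤1+n (m⊔n≤o⇒m≤o η _ q))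
lh-base {Γ} (suc k) [] p q = lh-iterate {Γ} {num k} 2 [] p q
lh-base (suc k) (η ∷ hs) p q = lh-church {A = num k} 2 hs p (m≤n⇒m≤1+n (m⊔n≤o⇒m≤o η _ q)) (m⊔n≤o⇒n≤o η _ q)

lh-power : ∀ {Γ} k {h} d hs → 2 ≤ h → maximum 0 hs ≤ h → lhApp (power {Γ} k h d) hs ≤ suc h
lh-power k     zero    hs p q = lh-base k hs p q
lh-power k {h} (suc d) hs p q = lh-church h hs ≤-refl (lh-power k d [] p z≤n) q

lh-saturate : ∀ {Γ} k (M : Γ ⊢ num (suc k)) {b} → 3 ≤ b → (∀ hs → maximum 0 hs ≤ b → lhApp M hs ≤ suc b) →
              ∀ hs → maximum 0 hs ≤ b → lhApp (saturate k M) hs ≤ suc b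
lh-saturate zero    M p f hs q = f (0 ∷ hs) q
lh-saturate (suc k) M p f hs q = lh-saturate k (M · base k) p
  (λ hs r → f (lh (base k) ∷ hs) (⊔-lub (≤-trans (lh-base k [] ≤-refl z≤n) p) r)) hs q

depth-iterate : ∀ {Γ A} h ds → maximum 1 ds ≤ 1 → depthApp (iterate {Γ} {A} h) ds ≤ 1
depth-iterate zero    ds q = q
depth-iterate (suc h) ds q = ⊔-lub (depth-iterate h [] ≤-refl) q

depth-church : ∀ {Γ A} h {δ} ds → maximum 1 ds ≤ 1 → depthApp (church {Γ} A h) (δ ∷ ds) ≤ 2 ⊔ suc δ
depth-church h []           q = ⊔-mono-≤ (≤-trans (depth-iterate h [] q) (n≤1+n 1)) ≤-refl
depth-church h {δ} (δ′ ∷ ds) q =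
  ⊔-mono-≤ (⊔-lub (≤-trans (depth-iterate h ds (m⊔n≤o⇒n≤o δ′ _ q)) (n≤1+n 1)) (s≤s (m⊔n≤o⇒m≤o δ′ _ q))) (≤-refl {suc δ})

depth-base₁ : ∀ {Γ} k → depth (base {Γ} k) ≤ 1
depth-base₁ zero    = ≤-refl
depth-base₁ (suc k) = ≤-refl

depth-base : ∀ {Γ} k ds → maximum 1 ds ≤ 1 → depthApp (base {Γ} k) ds ≤ 2
depth-base zero    []       q = s≤s z≤n
depth-base zero    (δ ∷ ds) q = ⊔-lub (≤-trans (m⊔n≤o⇒n≤o δ _ q) (n≤1+n 1)) (s≤s (m⊔n≤o⇒m≤o δ _ q))
depth-base (suc k) []       q = n≤1+n 1
depth-base (suc k) (δ ∷ ds) q = ≤-trans (depth-church {A = num k} 2 ds (m⊔n≤o⇒n≤o δ _ q)) (⊔-lub ≤-refl (s≤s (m⊔n≤o⇒m≤o δ _ q)))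

depth-power : ∀ {Γ} k h d ds → maximum 1 ds ≤ 1 → depthApp (power {Γ} k h d) ds ≤ 2 + d
depth-power k h zero    ds q = depth-base k ds q
depth-power k h (suc d) ds q =
  ≤-trans (depth-church h ds q) (⊔-lub (s≤s (s≤s z≤n)) (s≤s (depth-power k h d [] ≤-refl)))

depth-saturate : ∀ {Γ} k (M : Γ ⊢ num (suc k)) {b} → (∀ ds → maximum 1 ds ≤ 1 → depthApp M ds ≤ b) →
                 ∀ ds → maximum 1 ds ≤ 1 → depthApp (saturate k M) ds ≤ b
depth-saturate zero    M f ds q = f (1 ∷ ds) (⊔-lub ≤-refl q)
depth-saturate (suc k) M f ds q = depth-saturate k (M · base k)
  (λ ds r → f (depth (base k) ∷ ds) (⊔-lub (depth-base₁ k) r)) ds q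

data AllHold : List Set → Set₁ where
  []  : AllHold []
  _∷_ : ∀ {c cs} → c → AllHold cs → AllHold (c ∷ cs)

Scoped-iterate : ∀ {Γ A} h cs → Scoped (iterate {Γ} {A} h) cs
Scoped-iterate zero    cs = tt
Scoped-iterate (suc h) cs = Scoped-iterate h [] , tt

Scoped-church : ∀ {Γ A} h {cs} → AllHold cs → Scoped (church {Γ} A h) cs
Scoped-church h []           = Scoped-iterate h []
Scoped-church h (c ∷ [])     = c , Scoped-iterate h []
Scoped-church h (_∷_ {cs = _ ∷ cs} c (c′ ∷ p)) = c , c′ , Scoped-iterate h _

Scoped-base : ∀ {Γ} k {cs} → AllHold cs → Scoped (base {Γ} k) cs
Scoped-base zero    []      = tt
Scoped-base zero    (c ∷ p) = c , tt
Scoped-base (suc k) p       = Scoped-church 2 p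

Closed-[] : ∀ {A} (M : [] ⊢ A) → Closed M
Closed-[] M ()

Scoped-power : ∀ k h d {cs} → AllHold cs → Scoped (power {[]} k h d) cs
Scoped-power k h zero    p = Scoped-base k p
Scoped-power k h (suc d) p = Scoped-power k h d [] ,
  Scoped-church h (_∷_ {c = Closed (power k h d)} (Closed-[] (power k h d)) p)

Scoped-saturate : ∀ k (M : [] ⊢ num (suc k)) → (∀ {cs} → AllHold cs → Scoped M cs) →
                  ∀ {cs} → AllHold cs → Scoped (saturate k M) cs
Scoped-saturate zero    M f p = tt , f (_∷_ {c = Closed {[]} {o} ∗} (Closed-[] ∗) p)
Scoped-saturate (suc k) M f p = Scoped-saturate k (M · base k)
  (λ q → Scoped-base k [] , f (_∷_ {c = Closed {[]} (base k)} (Closed-[] (base k)) q)) p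

-- The body of the numeral `h` has local height h + 1. The applied base has depth at most 2, and
-- each of the d + 1 applications adds one. The bound 3 is the local height of the numeral 2.
program-admissible : ∀ k {h} d → 3 ≤ h → Admissible (2 + k) (suc h) (3 + d) (program k h d)
program-admissible k {h} d p = record
  { scoped = Scoped⇒StronglyLocallyScoped (program k h d) (Scoped-saturate k M (Scoped-power k h (suc d)) [])
  ; ord≤   = ord-saturate k M (n≤1+n _) (ord-power k h (suc d))
  ; lh≤    = lh-saturate k M p (λ hs → lh-power k (suc d) hs (<⇒≤ p)) [] z≤n
  ; depth≤ = depth-saturate k M (depth-power k h (suc d)) [] ≤-refl }
  where M = power k h (suc d)

-- Towers of reals

2^-cancel-≤ : ∀ {m n} → 2 ^ m ≤ 2 ^ n → m ≤ n
2^-cancel-≤ p = ≮⇒≥ λ q → <⇒≱ (^-monoʳ-< 2 ≤-refl q) p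

log-bounds : ∀ h → 1 ≤ h → ∃[ l ] 2 ^ l ≤ h × h < 2 ^ suc l
log-bounds (suc zero)    _ = 0 , ≤-refl , ≤-refl
log-bounds (suc (suc h)) _ with log-bounds (suc h) (s≤s z≤n)
... | l , p , q with suc (suc h) <? 2 ^ suc l
...   | yes r = l , m≤n⇒m≤1+n p , r
...   | no r  = suc l , ≮⇒≥ r , ≤-<-trans q (^-monoʳ-< 2 ≤-refl (n<1+n (suc l)))

-- The two ways in which the cuts of r express x ≤ r, and dually r ≤ x; for an
-- arbitrary pair of cuts neither determines the other.
Below : ℕ → ℝ⁺ → Set
Below x r = lower r x 1 × (∀ s t → .{{_ : NonZero t}} → upper r s t → x * t ≤ s)

Above : ℕ → ℝ⁺ → Set
Above x r = upper r x 1 × (∀ s t → .{{_ : NonZero t}} → lower r s t → s ≤ x * t)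

1^-* : ∀ a t → a * 1 ^ t ≡ a
1^-* a t = trans (cong (a *_) (^-zeroˡ t)) (*-identityʳ a)

-- The cuts of `2^ r` quantify over the opposite cuts of `r`, so each half of the conclusion comes
-- from the other half of the hypothesis.
Below-2^ : ∀ {x r} → Below x r → Below (2 ^ x) (2^ r)
Below-2^ {x} (p , q) =
  (λ s t u → subst₂ _≤_ (sym (^-*-assoc 2 x t)) (sym (1^-* (2 ^ s) t)) (2^-mono (q s t u))) ,
  (λ a b u → subst₂ _≤_ (cong (2 ^ x *_) (^-identityʳ b)) (^-identityʳ a) (u x 1 p))

Above-2^ : ∀ {x r} → Above x r → Above (2 ^ x) (2^ r)
Above-2^ {x} (p , q) =
  (λ s t u → subst₂ _≤_ (sym (1^-* (2 ^ s) t)) (sym (^-*-assoc 2 x t)) (2^-mono (q s t u))) ,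
  (λ a b u → subst₂ _≤_ (^-identityʳ a) (cong (2 ^ x *_) (^-identityʳ b)) (u x 1 p))

Below-tower : ∀ k {x r} → Below x r → Below (tow k x) (tower k r)
Below-tower zero    p = p
Below-tower (suc k) p = Below-2^ {r = tower k _} (Below-tower k p)

Above-tower : ∀ k {x r} → Above x r → Above (tow k x) (tower k r)
Above-tower zero    p = p
Above-tower (suc k) p = Above-2^ {r = tower k _} (Above-tower k p)

≤-tower : ∀ k {x r m} → Below x r → m ≤ tow (suc k) x → m ≤ℝ tower (suc k) r
≤-tower k {x} p q s t u =
  ≤-trans (^-monoˡ-≤ t q) (proj₁ (Below-2^ {r = tower k _} (Below-tower k p)) s t u)

tower-≤ : ∀ k {x r m} → Above x r → tow (suc k) x ≤ m → tower (suc k) r ℝ≤ m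
tower-≤ k {x} p q s t u =
  ≤-trans (proj₁ (Above-2^ {r = tower k _} (Above-tower k p)) s t u) (^-monoˡ-≤ t q)

Below-log : ∀ {h l} p d → 2 ^ l ≤ h → Below (p * d * l) (mkℚᵘ (ℤ.+ p) 0 · d ·log h)
Below-log {h} {l} p d q =
  subst₂ (λ a b → 2 ^ a ≤ h ^ b) (sym (*-identityʳ (p * d * l))) (sym (*-identityʳ (p * d))) (pow (p * d)) ,
  λ s t u → 2^-cancel-≤ (begin
    2 ^ (p * d * l * t)    ≡⟨ cong (2 ^_) (solve 3 (λ x l t → x :* l :* t := x :* t :* l) refl (p * d) l t) ⟩
    2 ^ (p * d * t * l)    ≤⟨ pow (p * d * t) ⟩
    h ^ (p * d * t)        ≤⟨ u ⟩
    2 ^ (s * 1)            ≡⟨ cong (2 ^_) (*-identityʳ s) ⟩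
    2 ^ s                  ∎)
  where
    open ≤-Reasoning
    pow : ∀ x → 2 ^ (x * l) ≤ h ^ x
    pow x = begin
      2 ^ (x * l)   ≡⟨ cong (2 ^_) (*-comm x l) ⟩
      2 ^ (l * x)   ≡⟨ sym (^-*-assoc 2 l x) ⟩
      (2 ^ l) ^ x   ≤⟨ ^-monoˡ-≤ x q ⟩
      h ^ x         ∎

Above-log : ∀ {h l x} q d → h ≤ 2 ^ l → l * d ≤ x * suc q → Above x (mkℚᵘ (ℤ.+ 1) q · d ·log h)
Above-log {h} {l} {x} q d p r =
  ≤-trans (pow (1 * d * 1)) (2^-mono (≤-trans (≤-reflexive (cong (l *_) (trans (*-identityʳ (1 * d)) (*-identityˡ d)))) r)) ,
  λ s t u → *-cancelʳ-≤ s (x * t) (suc q) (begin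
    s * suc q         ≤⟨ 2^-cancel-≤ (≤-trans u (pow (1 * d * t))) ⟩
    l * (1 * d * t)   ≡⟨ solve 3 (λ l d t → l :* (con 1 :* d :* t) := l :* d :* t) refl l d t ⟩
    l * d * t         ≤⟨ *-monoˡ-≤ t r ⟩
    x * suc q * t     ≡⟨ solve 3 (λ x q t → x :* q :* t := x :* t :* q) refl x (suc q) t ⟩
    x * t * suc q     ∎)
  where
    open ≤-Reasoning
    pow : ∀ y → h ^ y ≤ 2 ^ (l * y)
    pow y = ≤-trans (^-monoˡ-≤ y p) (≤-reflexive (^-*-assoc 2 l y))

-- Existence of the maximum, and the constants

¬¬-maximum : (P : ℕ → Set) → ∀ b j → P j → (∀ k → P k → k ≤ j + b) → ¬ ¬ (∃[ m ] P m × ∀ k → P k → k ≤ m)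
¬¬-maximum P zero    j p q r = r (j , p , λ k s → ≤-trans (q k s) (≤-reflexive (+-identityʳ j)))
-- Propose `j`; an element `k` above it refutes the proposal and restarts the search with a smaller
-- gap.
¬¬-maximum P (suc b) j p q r = r (j , p , λ k s → ≮⇒≥ λ j<k →
  ¬¬-maximum P b k s (λ l t → ≤-trans (q l t) (≤-trans (≤-reflexive (+-suc j b)) (+-monoˡ-≤ b j<k))) r)

Cost : ℕ → ℕ → ℕ → ℕ → Set
Cost n h d k = ∃[ Γ ] ∃[ A ] Σ[ M ∈ Γ ⊢ A ] Admissible n h d M × cost M ≡ k

L-exists : ∀ {n h d k} b → Cost n h d k → (∀ {Γ A} (M : Γ ⊢ A) → Admissible n h d M → cost M ≤ b) →
           ¬ ¬ (∃[ m ] L n h d m)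
L-exists {n} {h} {d} {k} b c cost≤ no-max =
  ¬¬-maximum (Cost n h d) b k c
    (λ { _ (_ , _ , M , a , refl) → ≤-trans (cost≤ M a) (m≤n+m b k) })
    λ { (_ , (Γ , A , M , a , refl) , max) →
      no-max (cost M , (Γ , A , M , a , 𝒩-cost M) , λ M′ a′ → cost M′ , 𝒩-cost M′ , max _ (_ , _ , M′ , a′ , refl)) }

2^l≤n : ∀ l {n} → 2 ^ suc l ≤ suc n → 2 ^ l ≤ n
2^l≤n l {n} p = ≤-pred (begin
  suc (2 ^ l)       ≤⟨ +-monoˡ-≤ (2 ^ l) (1≤2^ l) ⟩
  2 ^ l + 2 ^ l     ≡⟨ 2^+2^ l ⟩
  2 ^ suc l         ≤⟨ p ⟩
  suc n             ∎)
  where open ≤-Reasoning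

-- Equality at a = b = 0 accounts for the constant 6.
exponent-bound : ∀ a b → (3 + a) * (4 + b) ≤ (1 + a) * (2 + b) * 6
exponent-bound a b = begin
  (3 + a) * (4 + b)                                  ≤⟨ m≤m+n _ _ ⟩
  (3 + a) * (4 + b) + (8 * a + 3 * b + 5 * a * b)    ≡⟨ solve 2 (λ a b →
    (con 3 :+ a) :* (con 4 :+ b) :+ (con 8 :* a :+ con 3 :* b :+ con 5 :* a :* b)
      := (con 1 :+ a) :* (con 2 :+ b) :* con 6) refl a b ⟩
  (1 + a) * (2 + b) * 6                              ∎
  where open ≤-Reasoning

theorem5p52 : ∀ (n : ℕ) → 2 ≤ n →
    Σ[ c₁ ∈ ℚᵘ ] Σ[ c₂ ∈ ℚᵘ ] Σ[ K ∈ ℕ ] Positive c₁ × Positive c₂ ×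
    (∀ (h d : ℕ) → K ≤ h → K ≤ d →
    ¬ ¬ (∃[ m ] L n h d m) ×
    (∀ (m : ℕ) → L n h d m →
    tower (n ∸ 1) (c₁ · d ·log h) ℝ≤ m ×
    m ≤ℝ tower (n ∸ 1) (c₂ · d ·log h)))
-- `mkℚᵘ` takes the denominator minus one, so the constants are 1/6 and 13.
theorem5p52 (suc (suc n)) (s≤s (s≤s z≤n)) = mkℚᵘ (ℤ.+ 1) 5 , mkℚᵘ (ℤ.+ 13) 0 , 4 , _ , _ , main
  where
    main : ∀ h d → 4 ≤ h → 4 ≤ d → ¬ ¬ (∃[ m ] L (2 + n) h d m) ×
           (∀ m → L (2 + n) h d m → tower (suc n) (mkℚᵘ (ℤ.+ 1) 5 · d ·log h) ℝ≤ m ×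
                                    m ≤ℝ tower (suc n) (mkℚᵘ (ℤ.+ 13) 0 · d ·log h))
    main (suc h) (suc (suc (suc (suc d)))) (s≤s 3≤h) (s≤s (s≤s (s≤s (s≤s z≤n))))
      with log-bounds (suc h) (s≤s z≤n)
    ... | 0 , _ , h< = ⊥-elim (<⇒≱ h< (s≤s (≤-trans (s≤s z≤n) 3≤h)))
    ... | 1 , _ , h< = ⊥-elim (<⇒≱ h< (s≤s 3≤h))
    ... | suc (suc l) , l≤ , h< =
      L-exists (tow (suc n) (13 * D * suc (suc l))) (_ , _ , P , admissible , refl) upper-bound ,
      λ { m ((_ , _ , M , a , N) , max) →
        let _ , N′ , k≤m = max P admissible in
        tower-≤ n (Above-log {l = 3 + l} {x} 5 D (<⇒≤ h<) (exponent-bound l d))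
          (≤-trans (program-cost n h (suc d) {x} x-bound)
            (≤-trans (≤-reflexive (sym (𝒩-unique N′))) k≤m)) ,
        ≤-tower n (Below-log {l = 2 + l} 13 D l≤) (≤-trans (≤-reflexive (𝒩-unique N)) (upper-bound M a)) }
      where
        D = 4 + d
        P = program n h (suc d)
        -- `P` applies the numeral `h`, which is at least 2^(1 + l), to the base 2 + d times.
        x = (1 + l) * (2 + d)
        admissible : Admissible (2 + n) (suc h) D P
        admissible = program-admissible n (suc d) 3≤h
        upper-bound : ∀ {Γ A} (M : Γ ⊢ A) → Admissible (2 + n) (suc h) D M →
                      cost M ≤ tow (suc n) (13 * D * suc (suc l))
        upper-bound M a = cost-≤-tow {l = 2 + l} M (s≤s z≤n) (s≤s z≤n) h< a
        x-bound : 2 ^ x ≤ h ^ (2 + d)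
        x-bound = ≤-trans (≤-reflexive (sym (^-*-assoc 2 (1 + l) (2 + d)))) (^-monoˡ-≤ (2 + d) (2^l≤n (1 + l) l≤))
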